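{- Let $\Delta=\Delta(p)$ be a function of the prime $p$ with $\Delta(p)\to\infty$ as $p\to\infty$. Then the set $$\{qy\pmod p:\ 1\le q\le p^{1/2},\ q\text{ prime},\ 1\le y\le \Delta\, p^{1/2}\log p\}$$ (with $y$ an integer) contains $(1+O(\Delta^{ -1}))\,p$ residue classes modulo $p$.
   Context: The statement is asymptotic as the prime $p\to\infty$ (i.e. for all sufficiently large $p$), and the constant implied by $O$ does not depend on $p$. -}

module Defs where

open import Data.Fin.Base using (Fin)
open import Data.Fin.Subset using (Subset; _∈_)
open import Data.Integer.Base as ℤ using (+_; +[1+_])
import Data.Integer.Properties as ℤ
open import Data.Nat.Base as ℕ using (ℕ; zero; suc; z≤n; s≤s)
open import Data.Nat.DivMod using (_mod_)
open import Data.Nat.Primality using (Prime)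
import Data.Nat.Properties as ℕ
import Data.Nat.Solver as ℕ-Solver
open import Data.Product.Base using (∃-syntax; _×_; _,_; proj₁; proj₂)
open import Data.Rational.Base as ℚ using (ℚ; mkℚ; 0ℚ; 1ℚ; ½; toℚᵘ; fromℚᵘ)
import Data.Rational.Properties as ℚ
open import Data.Rational.Solver using (module +-*-Solver)
open import Data.Rational.Unnormalised.Base as ℚᵘ using (mkℚᵘ)
import Data.Rational.Unnormalised.Properties as ℚᵘ
open import Data.Sum.Base using (inj₁; inj₂)
open import Function.Bundles using (_⇔_)
open import Level using (0ℓ)
open import Relation.Binary.PropositionalEquality
  using (_≡_; refl; sym; trans; cong; cong₂; subst; subst₂)
open import Relation.Nullary using (yes; no)
open import Relation.Unary using (Pred)

------------------------------------------------------------------------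
-- Auxiliary facts about ℚ

module Rationals where

  open import Data.Rational.Base hiding (mkℚ)
  open ℚ.≤-Reasoning
  open +-*-Solver using (solve; _:=_; _:+_; _:*_; _:-_; :-_)

  frac : (a b : ℕ) .{{_ : ℕ.NonZero b}} → ℚ
  frac a b = (+ a) / b

  toℚᵘ-frac : ∀ a b → toℚᵘ (frac a (suc b)) ℚᵘ.≃ mkℚᵘ (+ a) b
  toℚᵘ-frac a b = ℚ.toℚᵘ-fromℚᵘ (mkℚᵘ (+ a) b)

  frac-≤ : ∀ {a b c d} .{{_ : ℕ.NonZero b}} .{{_ : ℕ.NonZero d}} →
           a ℕ.* d ℕ.≤ c ℕ.* b → frac a b ≤ frac c d
  frac-≤ {a} {suc b} {c} {suc d} ad≤cb = ℚ.toℚᵘ-cancel-≤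
    (ℚᵘ.≤-respˡ-≃ (ℚᵘ.≃-sym {toℚᵘ (frac a (suc b))} (toℚᵘ-frac a b))
    (ℚᵘ.≤-respʳ-≃ (ℚᵘ.≃-sym {toℚᵘ (frac c (suc d))} (toℚᵘ-frac c d))
    (ℚᵘ.*≤* (subst₂ ℤ._≤_ (ℤ.pos-* a (suc d)) (ℤ.pos-* c (suc b)) (ℤ.+≤+ ad≤cb)))))

  frac1-antimono : ∀ {m n} .{{_ : ℕ.NonZero m}} .{{_ : ℕ.NonZero n}} →
                   m ℕ.≤ n → frac 1 n ≤ frac 1 m
  frac1-antimono {m} {n} m≤n = frac-≤ {1} {n} {1} {m} (ℕ.*-monoʳ-≤ 1 m≤n)

  frac-+ : ∀ a b n .{{_ : ℕ.NonZero n}} → frac (a ℕ.+ b) n ≡ frac a n + frac b n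
  frac-+ a b (suc n) = ℚ.toℚᵘ-injective
    (ℚᵘ.≃-trans {toℚᵘ (frac (a ℕ.+ b) (suc n))} (toℚᵘ-frac (a ℕ.+ b) n)
    (ℚᵘ.≃-trans {_} {mkℚᵘ (+ a) n ℚᵘ.+ mkℚᵘ (+ b) n} (ℚᵘ.*≡* eq)
    (ℚᵘ.≃-sym {toℚᵘ (frac a (suc n) + frac b (suc n))}
    (ℚᵘ.≃-trans (ℚ.toℚᵘ-homo-+ (frac a (suc n)) (frac b (suc n)))
      (ℚᵘ.+-cong (toℚᵘ-frac a n) (toℚᵘ-frac b n))))))
    where
    s = + suc n
    eq : + (a ℕ.+ b) ℤ.* (s ℤ.* s) ≡ (+ a ℤ.* s ℤ.+ + b ℤ.* s) ℤ.* s
    eq = trans (sym (ℤ.*-assoc (+ (a ℕ.+ b)) s s))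
               (cong (ℤ._* s) (trans (cong (ℤ._* s) (ℤ.pos-+ a b)) (ℤ.*-distribʳ-+ s (+ a) (+ b))))

  frac-nonNeg : ∀ a b .{{_ : ℕ.NonZero b}} → 0ℚ ≤ frac a b
  frac-nonNeg a b = ℚ.nonNegative⁻¹ _ {{ℚ.normalize-nonNeg a b}}

  archimedean : ∀ {ε} → 0ℚ < ε → ∃[ k ] frac 1 (suc k) ≤ ε
  archimedean {mkℚ +[1+ n ] d c} _ = d , ℚ.toℚᵘ-cancel-≤
    (ℚᵘ.≤-respˡ-≃ (ℚᵘ.≃-sym {toℚᵘ (frac 1 (suc d))} (toℚᵘ-frac 1 d))
      (ℚᵘ.*≤* (ℤ.*-monoʳ-≤-nonNeg (+ suc d) {+ 1} {+[1+ n ]} (ℤ.+≤+ (s≤s z≤n)))))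
  archimedean {mkℚ (+ 0) d c} (*<* (ℤ.+<+ ()))
  archimedean {mkℚ ℤ.-[1+ n ] d c} (*<* ())

  ring₁ : ∀ a b c d → a * b - c * d ≡ a * (b - d) + d * (a - c)
  ring₁ = solve 4 (λ a b c d → a :* b :- c :* d := a :* (b :- d) :+ d :* (a :- c)) refl

  ring₃ : ∀ a b u v → b * v * u - a * u * v ≡ (b - a) * (u * v)
  ring₃ = solve 4 (λ a b u v → b :* v :* u :- a :* u :* v := (b :- a) :* (u :* v)) refl

  ring₄ : ∀ ε δ w → ε * (δ * δ) * (w * w) ≡ ε * ((δ * w) * (δ * w))
  ring₄ = solve 3 (λ ε δ w → ε :* (δ :* δ) :* (w :* w) := ε :* ((δ :* w) :* (δ :* w))) refl

  ring₅ : ∀ a b c d → (a + b) - (c + d) ≡ (a - c) + (b - d)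
  ring₅ = solve 4 (λ a b c d → (a :+ b) :- (c :+ d) := (a :- c) :+ (b :- d)) refl

  ring₂ : ∀ a b c → a + b + c ≡ a + c + b
  ring₂ = solve 3 (λ a b c → a :+ b :+ c := a :+ c :+ b) refl

  +-swap-- : ∀ x y z → x ≤ y + z → x - y ≤ z
  +-swap-- x y z x≤y+z = begin
    x - y        ≤⟨ ℚ.+-monoˡ-≤ (- y) x≤y+z ⟩
    y + z - y    ≡⟨ solve 2 (λ y z → y :+ z :- y := z) refl y z ⟩
    z            ∎

  ∣-∣-≤ : ∀ x y z → x ≤ y + z → y ≤ x + z → ∣ x - y ∣ ≤ z
  ∣-∣-≤ x y z x≤ y≤ with ℚ.∣p∣≡p∨∣p∣≡-p (x - y)
  ... | inj₁ eq = subst (_≤ z) (sym eq) (+-swap-- x y z x≤)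
  ... | inj₂ eq = subst (_≤ z)
    (sym (trans eq (solve 2 (λ x y → :- (x :- y) := y :- x) refl x y))) (+-swap-- y x z y≤)

  x≤∣x∣ : ∀ x → x ≤ ∣ x ∣
  x≤∣x∣ x with ℚ.≤-total 0ℚ x
  ... | inj₁ 0≤x = ℚ.≤-reflexive (sym (ℚ.0≤p⇒∣p∣≡p 0≤x))
  ... | inj₂ x≤0 = ℚ.≤-trans x≤0 (ℚ.0≤∣p∣ x)

  ∣-∣-comm : ∀ x y → ∣ x - y ∣ ≡ ∣ y - x ∣
  ∣-∣-comm x y = trans (sym (ℚ.∣-p∣≡∣p∣ (x - y)))
    (cong ∣_∣ (solve 2 (λ x y → :- (x :- y) := y :- x) refl x y))

  ∣x∣≤∣y∣+∣x-y∣ : ∀ x y → ∣ x ∣ ≤ ∣ y ∣ + ∣ x - y ∣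
  ∣x∣≤∣y∣+∣x-y∣ x y = begin
    ∣ x ∣             ≡⟨ cong ∣_∣ (solve 2 (λ x y → x := y :+ (x :- y)) refl x y) ⟩
    ∣ y + (x - y) ∣   ≤⟨ ℚ.∣p+q∣≤∣p∣+∣q∣ y (x - y) ⟩
    ∣ y ∣ + ∣ x - y ∣ ∎

  *-mono-≤ : ∀ {a b c d} → 0ℚ ≤ a → a ≤ b → 0ℚ ≤ c → c ≤ d → a * c ≤ b * d
  *-mono-≤ {a} {b} {c} {d} 0≤a a≤b 0≤c c≤d = begin
    a * c ≤⟨ ℚ.*-monoʳ-≤-nonNeg c {{nonNegative 0≤c}} a≤b ⟩
    b * c ≤⟨ ℚ.*-monoˡ-≤-nonNeg b {{nonNegative (ℚ.≤-trans 0≤a a≤b)}} c≤d ⟩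
    b * d ∎

  *-pos : ∀ {a b} → 0ℚ < a → 0ℚ < b → 0ℚ < a * b
  *-pos {a} {b} 0<a 0<b =
    ℚ.positive⁻¹ (a * b) {{ℚ.pos*pos⇒pos a {{positive 0<a}} b {{positive 0<b}}}}

  0<½ : 0ℚ < ½
  0<½ = ℚ.positive⁻¹ ½

  ½-+ : ∀ x → ½ * x + ½ * x ≡ x
  ½-+ x = trans (sym (ℚ.*-distribʳ-+ x ½ ½)) (ℚ.*-identityˡ x)

  1/-pos : ∀ {a} (0<a : 0ℚ < a) → 0ℚ < (1/ a) {{>-nonZero 0<a}}
  1/-pos {a} 0<a = ℚ.positive⁻¹ _ {{ℚ.1/pos⇒pos a {{positive 0<a}}}}

  1/-antimono : ∀ {a b} (0<a : 0ℚ < a) (0<b : 0ℚ < b) → a ≤ b →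
                (1/ b) {{>-nonZero 0<b}} ≤ (1/ a) {{>-nonZero 0<a}}
  1/-antimono {a} {b} 0<a 0<b a≤b = begin
    v             ≡⟨ ℚ.*-identityʳ v ⟨
    v * 1ℚ        ≡⟨ cong (v *_) (ℚ.*-inverseʳ a {{a≢0}}) ⟨
    v * (a * u)   ≤⟨ ℚ.*-monoˡ-≤-nonNeg v {{nonNegative (ℚ.<⇒≤ (1/-pos 0<b))}}
                       (ℚ.*-monoʳ-≤-nonNeg u {{nonNegative (ℚ.<⇒≤ (1/-pos 0<a))}} a≤b) ⟩
    v * (b * u)   ≡⟨ ℚ.*-assoc v b u ⟨
    v * b * u     ≡⟨ cong (_* u) (ℚ.*-inverseˡ b {{b≢0}}) ⟩
    1ℚ * u        ≡⟨ ℚ.*-identityˡ u ⟩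
    u             ∎
    where
    a≢0 = >-nonZero 0<a
    b≢0 = >-nonZero 0<b
    u = (1/ a) {{a≢0}}
    v = (1/ b) {{b≢0}}

  divide : ∀ {ε b} → 0ℚ < ε → 0ℚ < b → ∃[ δ ] (0ℚ < δ × b * δ ≡ ε)
  divide {ε} {b} 0<ε 0<b = u * ε , *-pos (1/-pos 0<b) 0<ε ,
    trans (sym (ℚ.*-assoc b u ε)) (trans (cong (_* ε) (ℚ.*-inverseʳ b)) (ℚ.*-identityˡ ε))
    where
    instance b≢0 = >-nonZero 0<b
    u = 1/ b

  ∣1/-1/∣ : ∀ a b u v → a * u ≡ 1ℚ → b * v ≡ 1ℚ → 0ℚ ≤ u * v →
            ∣ u - v ∣ ≡ ∣ b - a ∣ * (u * v)
  ∣1/-1/∣ a b u v au≡1 bv≡1 0≤uv = begin-equality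
    ∣ u - v ∣
      ≡⟨ cong ∣_∣ (cong₂ _-_ (ℚ.*-identityˡ u) (ℚ.*-identityˡ v)) ⟨
    ∣ 1ℚ * u - 1ℚ * v ∣
      ≡⟨ cong₂ (λ p q → ∣ p * u - q * v ∣) bv≡1 au≡1 ⟨
    ∣ b * v * u - a * u * v ∣
      ≡⟨ cong ∣_∣ (ring₃ a b u v) ⟩
    ∣ (b - a) * (u * v) ∣
      ≡⟨ ℚ.∣p*q∣≡∣p∣*∣q∣ (b - a) (u * v) ⟩
    ∣ b - a ∣ * ∣ u * v ∣
      ≡⟨ cong (∣ b - a ∣ *_) (ℚ.0≤p⇒∣p∣≡p 0≤uv) ⟩
    ∣ b - a ∣ * (u * v) ∎

  *-1/-1/ : ∀ ε δ w → δ * w ≡ 1ℚ → ε * (δ * δ) * (w * w) ≡ ε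
  *-1/-1/ ε δ w δw≡1 = begin-equality
    ε * (δ * δ) * (w * w)     ≡⟨ ring₄ ε δ w ⟩
    ε * ((δ * w) * (δ * w))   ≡⟨ cong (λ z → ε * (z * z)) δw≡1 ⟩
    ε * (1ℚ * 1ℚ)             ≡⟨ cong (ε *_) (ℚ.*-identityˡ 1ℚ) ⟩
    ε * 1ℚ                    ≡⟨ ℚ.*-identityʳ ε ⟩
    ε ∎

  0≤* : ∀ {a b} → 0ℚ ≤ a → 0ℚ ≤ b → 0ℚ ≤ a * b
  0≤* {a} {b} 0≤a 0≤b =
    ℚ.nonNegative⁻¹ _ {{ℚ.nonNeg*nonNeg⇒nonNeg a {{nonNegative 0≤a}} b {{nonNegative 0≤b}}}}

  ∣*-*∣ : ∀ a b c d B C δ → ∣ a ∣ ≤ B → ∣ d ∣ ≤ C → ∣ a - c ∣ ≤ δ → ∣ b - d ∣ ≤ δ →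
          ∣ a * b - c * d ∣ ≤ (B + C) * δ
  ∣*-*∣ a b c d B C δ ∣a∣≤B ∣d∣≤C ∣a-c∣≤δ ∣b-d∣≤δ = begin
    ∣ a * b - c * d ∣
      ≡⟨ cong ∣_∣ (ring₁ a b c d) ⟩
    ∣ a * (b - d) + d * (a - c) ∣
      ≤⟨ ℚ.∣p+q∣≤∣p∣+∣q∣ (a * (b - d)) (d * (a - c)) ⟩
    ∣ a * (b - d) ∣ + ∣ d * (a - c) ∣
      ≡⟨ cong₂ _+_ (ℚ.∣p*q∣≡∣p∣*∣q∣ a (b - d)) (ℚ.∣p*q∣≡∣p∣*∣q∣ d (a - c)) ⟩
    ∣ a ∣ * ∣ b - d ∣ + ∣ d ∣ * ∣ a - c ∣
      ≤⟨ ℚ.+-mono-≤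
           (*-mono-≤ {∣ a ∣} {B} {∣ b - d ∣} {δ} (ℚ.0≤∣p∣ a) ∣a∣≤B (ℚ.0≤∣p∣ (b - d)) ∣b-d∣≤δ)
           (*-mono-≤ {∣ d ∣} {C} {∣ a - c ∣} {δ} (ℚ.0≤∣p∣ d) ∣d∣≤C (ℚ.0≤∣p∣ (a - c)) ∣a-c∣≤δ) ⟩
    B * δ + C * δ
      ≡⟨ ℚ.*-distribʳ-+ δ B C ⟨
    (B + C) * δ ∎

  -- ∑ n f = f 0 + … + f (n - 1)
  ∑ : ℕ → (ℕ → ℚ) → ℚ
  ∑ zero    f = 0ℚ
  ∑ (suc n) f = ∑ n f + f n

  ∑-mono : ∀ n {f g} → (∀ i → i ℕ.< n → f i ≤ g i) → ∑ n f ≤ ∑ n g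
  ∑-mono zero    f≤g = ℚ.≤-refl
  ∑-mono (suc n) f≤g =
    ℚ.+-mono-≤ (∑-mono n (λ i i<n → f≤g i (ℕ.m<n⇒m<1+n i<n))) (f≤g n ℕ.≤-refl)

  ∑-++ : ∀ m n f → ∑ (m ℕ.+ n) f ≡ ∑ m f + ∑ n (λ j → f (m ℕ.+ j))
  ∑-++ m zero    f = trans (cong (λ k → ∑ k f) (ℕ.+-identityʳ m)) (sym (ℚ.+-identityʳ (∑ m f)))
  ∑-++ m (suc n) f = trans (cong (λ k → ∑ k f) (ℕ.+-suc m n))
    (trans (cong (_+ f (m ℕ.+ n)) (∑-++ m n f)) (ℚ.+-assoc (∑ m f) _ _))

  ∑-blocks : ∀ a k f → ∑ (a ℕ.* k) f ≡ ∑ a (λ i → ∑ k (λ j → f (i ℕ.* k ℕ.+ j)))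
  ∑-blocks zero    k f = refl
  ∑-blocks (suc a) k f = trans (cong (λ n → ∑ n f) (ℕ.+-comm k (a ℕ.* k)))
    (trans (∑-++ (a ℕ.* k) k f) (cong (_+ ∑ k (λ j → f (a ℕ.* k ℕ.+ j))) (∑-blocks a k f)))

  ∑-const : ∀ n d .{{_ : ℕ.NonZero d}} → ∑ n (λ _ → frac 1 d) ≡ frac n d
  ∑-const zero    d = sym (ℚ.0/n≡0 d)
  ∑-const (suc n) d = trans (cong (_+ frac 1 d) (∑-const n d))
    (trans (sym (frac-+ n 1 d)) (cong (λ a → frac a d) (ℕ.+-comm n 1)))

open Rationals

------------------------------------------------------------------------
-- Real numbers as Cauchy sequences of rationals

IsCauchy : (ℕ → ℚ) → Set
IsCauchy x = ∀ ε → 0ℚ ℚ.< ε →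
  ∃[ N ] (∀ m n → N ℕ.≤ m → N ℕ.≤ n → ℚ.∣ x m ℚ.- x n ∣ ℚ.≤ ε)

record ℝ : Set where
  constructor mkℝ
  field
    seq    : ℕ → ℚ
    cauchy : IsCauchy seq

open ℝ public

infix 4 _≤_ _<_ _≃_

_≤_ _<_ _≃_ : ℝ → ℝ → Set
x ≤ y = ∀ ε → 0ℚ ℚ.< ε → ∃[ N ] (∀ n → N ℕ.≤ n → seq x n ℚ.≤ seq y n ℚ.+ ε)
x < y = ∃[ ε ] (0ℚ ℚ.< ε × ∃[ N ] (∀ n → N ℕ.≤ n → seq x n ℚ.+ ε ℚ.≤ seq y n))
x ≃ y = x ≤ y × y ≤ x

fromℚ : ℚ → ℝ
fromℚ q = mkℝ (λ _ → q) λ ε 0<ε →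
  0 , λ _ _ _ _ → subst (λ z → ℚ.∣ z ∣ ℚ.≤ ε) (sym (ℚ.+-inverseʳ q)) (ℚ.<⇒≤ 0<ε)

fromℕ : ℕ → ℝ
fromℕ n = fromℚ (+ n ℚ./ 1)

0ℝ 1ℝ : ℝ
0ℝ = fromℚ 0ℚ
1ℝ = fromℚ 1ℚ

module CauchySequences where

  open ℚ.≤-Reasoning

  ⊔-≤ˡ : ∀ {a b c} → a ℕ.⊔ b ℕ.≤ c → a ℕ.≤ c
  ⊔-≤ˡ {a} {b} = ℕ.≤-trans (ℕ.m≤m⊔n a b)

  ⊔-≤ʳ : ∀ {a b c} → a ℕ.⊔ b ℕ.≤ c → b ℕ.≤ c
  ⊔-≤ʳ {a} {b} = ℕ.≤-trans (ℕ.m≤n⊔m a b)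

  +-cauchy : ∀ x y → IsCauchy (λ n → seq x n ℚ.+ seq y n)
  +-cauchy (mkℝ x cx) (mkℝ y cy) ε 0<ε
    with cx (½ ℚ.* ε) (*-pos 0<½ 0<ε) | cy (½ ℚ.* ε) (*-pos 0<½ 0<ε)
  ... | M , M-ok | N , N-ok = M ℕ.⊔ N , λ m n m≥ n≥ → begin
    ℚ.∣ (x m ℚ.+ y m) ℚ.- (x n ℚ.+ y n) ∣
      ≡⟨ cong ℚ.∣_∣ (ring₅ (x m) (y m) (x n) (y n)) ⟩
    ℚ.∣ (x m ℚ.- x n) ℚ.+ (y m ℚ.- y n) ∣
      ≤⟨ ℚ.∣p+q∣≤∣p∣+∣q∣ (x m ℚ.- x n) (y m ℚ.- y n) ⟩
    ℚ.∣ x m ℚ.- x n ∣ ℚ.+ ℚ.∣ y m ℚ.- y n ∣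
      ≤⟨ ℚ.+-mono-≤ (M-ok m n (⊔-≤ˡ m≥) (⊔-≤ˡ n≥)) (N-ok m n (⊔-≤ʳ {M} m≥) (⊔-≤ʳ {M} n≥)) ⟩
    ½ ℚ.* ε ℚ.+ ½ ℚ.* ε
      ≡⟨ ½-+ ε ⟩
    ε ∎

  ∣∣-cauchy : ∀ x → IsCauchy (λ n → ℚ.∣ seq x n ∣)
  ∣∣-cauchy (mkℝ x cx) ε 0<ε with cx ε 0<ε
  ... | N , N-ok = N , λ m n m≥ n≥ → ∣-∣-≤ ℚ.∣ x m ∣ ℚ.∣ x n ∣ ε
    (ℚ.≤-trans (∣x∣≤∣y∣+∣x-y∣ (x m) (x n)) (ℚ.+-monoʳ-≤ ℚ.∣ x n ∣ (N-ok m n m≥ n≥)))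
    (ℚ.≤-trans (∣x∣≤∣y∣+∣x-y∣ (x n) (x m)) (ℚ.+-monoʳ-≤ ℚ.∣ x m ∣ (N-ok n m n≥ m≥)))

  bounded : ∀ x → ∃[ B ] (0ℚ ℚ.< B × ∃[ N ] (∀ n → N ℕ.≤ n → ℚ.∣ seq x n ∣ ℚ.≤ B))
  bounded (mkℝ x cx) with cx 1ℚ (ℚ.positive⁻¹ 1ℚ)
  ... | N , N-ok = ℚ.∣ x N ∣ ℚ.+ 1ℚ
    , ℚ.+-mono-≤-< (ℚ.0≤∣p∣ (x N)) (ℚ.positive⁻¹ 1ℚ)
    , N , λ n n≥ → ℚ.≤-trans (∣x∣≤∣y∣+∣x-y∣ (x n) (x N))
                     (ℚ.+-monoʳ-≤ ℚ.∣ x N ∣ (N-ok n N n≥ ℕ.≤-refl))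

  *-cauchy : ∀ x y → IsCauchy (λ n → seq x n ℚ.* seq y n)
  *-cauchy x y ε 0<ε =
    let B , 0<B , K , K-ok = bounded x
        C , 0<C , L , L-ok = bounded y
        δ , 0<δ , [B+C]δ≡ε = divide 0<ε (ℚ.+-mono-< 0<B 0<C)
        M , M-ok = cauchy x δ 0<δ
        N , N-ok = cauchy y δ 0<δ
    in (K ℕ.⊔ L) ℕ.⊔ (M ℕ.⊔ N) , λ m n m≥ n≥ →
    subst (ℚ.∣ seq x m ℚ.* seq y m ℚ.- seq x n ℚ.* seq y n ∣ ℚ.≤_) [B+C]δ≡ε
      (∣*-*∣ (seq x m) (seq y m) (seq x n) (seq y n) B C δ
        (K-ok m (⊔-≤ˡ {K} (⊔-≤ˡ {K ℕ.⊔ L} m≥)))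
        (L-ok n (⊔-≤ʳ {K} (⊔-≤ˡ {K ℕ.⊔ L} n≥)))
        (M-ok m n (⊔-≤ˡ {M} (⊔-≤ʳ {K ℕ.⊔ L} m≥)) (⊔-≤ˡ {M} (⊔-≤ʳ {K ℕ.⊔ L} n≥)))
        (N-ok m n (⊔-≤ʳ {M} (⊔-≤ʳ {K ℕ.⊔ L} m≥)) (⊔-≤ʳ {M} (⊔-≤ʳ {K ℕ.⊔ L} n≥))))

  0<⊔ : ∀ {δ} q → 0ℚ ℚ.< δ → 0ℚ ℚ.< δ ℚ.⊔ q
  0<⊔ {δ} q 0<δ = ℚ.<-≤-trans 0<δ (ℚ.p≤p⊔q δ q)

  1/⊔ : ∀ {δ} → 0ℚ ℚ.< δ → ℚ → ℚ
  1/⊔ {δ} 0<δ q = (ℚ.1/ (δ ℚ.⊔ q)) {{ℚ.>-nonZero (0<⊔ q 0<δ)}}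

  ⁻¹-cauchy : ∀ x {δ} (0<δ : 0ℚ ℚ.< δ) N → (∀ n → N ℕ.≤ n → 0ℚ ℚ.+ δ ℚ.≤ seq x n) →
              IsCauchy (λ n → 1/⊔ 0<δ (seq x n))
  ⁻¹-cauchy (mkℝ x cx) {δ} 0<δ N δ≤ ε 0<ε
    with cx (ε ℚ.* (δ ℚ.* δ)) (*-pos 0<ε (*-pos 0<δ 0<δ))
  ... | M , M-ok = N ℕ.⊔ M , λ m n m≥ n≥ → begin
    ℚ.∣ u m ℚ.- u n ∣
      ≡⟨ ∣1/-1/∣ (a m) (a n) (u m) (u n) (au≡1 m) (au≡1 n) (0≤* (0≤u m) (0≤u n)) ⟩
    ℚ.∣ a n ℚ.- a m ∣ ℚ.* (u m ℚ.* u n)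
      ≡⟨ cong₂ (λ p q → ℚ.∣ p ℚ.- q ∣ ℚ.* (u m ℚ.* u n))
               (a≡x n (⊔-≤ˡ n≥)) (a≡x m (⊔-≤ˡ m≥)) ⟩
    ℚ.∣ x n ℚ.- x m ∣ ℚ.* (u m ℚ.* u n)
      ≤⟨ *-mono-≤ {ℚ.∣ x n ℚ.- x m ∣} {ε ℚ.* (δ ℚ.* δ)} {u m ℚ.* u n} {w ℚ.* w}
                  (ℚ.0≤∣p∣ (x n ℚ.- x m)) (M-ok n m (⊔-≤ʳ {N} n≥) (⊔-≤ʳ {N} m≥))
                  (0≤* (0≤u m) (0≤u n)) (*-mono-≤ {u m} {w} {u n} {w} (0≤u m) (u≤w m) (0≤u n) (u≤w n)) ⟩
    ε ℚ.* (δ ℚ.* δ) ℚ.* (w ℚ.* w)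
      ≡⟨ *-1/-1/ ε δ w (ℚ.*-inverseʳ δ {{ℚ.>-nonZero 0<δ}}) ⟩
    ε ∎
    where
    a u : ℕ → ℚ
    a n = δ ℚ.⊔ x n
    u n = 1/⊔ 0<δ (x n)
    w : ℚ
    w = (ℚ.1/ δ) {{ℚ.>-nonZero 0<δ}}
    au≡1 : ∀ n → a n ℚ.* u n ≡ 1ℚ
    au≡1 n = ℚ.*-inverseʳ (a n) {{ℚ.>-nonZero (0<⊔ (x n) 0<δ)}}
    0≤u : ∀ n → 0ℚ ℚ.≤ u n
    0≤u n = ℚ.<⇒≤ (1/-pos (0<⊔ (x n) 0<δ))
    u≤w : ∀ n → u n ℚ.≤ w
    u≤w n = 1/-antimono 0<δ (0<⊔ (x n) 0<δ) (ℚ.p≤p⊔q δ (x n))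
    a≡x : ∀ n → N ℕ.≤ n → a n ≡ x n
    a≡x n n≥ = ℚ.p≤q⇒p⊔q≡q (subst (ℚ._≤ x n) (ℚ.+-identityˡ δ) (δ≤ n n≥))

  regular⇒cauchy : ∀ x → (∀ m n → x m ℚ.≤ x n ℚ.+ frac 1 (suc n)) → IsCauchy x
  regular⇒cauchy x x≤ ε 0<ε with archimedean 0<ε
  ... | k , 1/k≤ε = k , λ m n m≥ n≥ → ∣-∣-≤ (x m) (x n) ε (x≤+ε m n n≥) (x≤+ε n m m≥)
    where
    x≤+ε : ∀ m n → k ℕ.≤ n → x m ℚ.≤ x n ℚ.+ ε
    x≤+ε m n k≤n = ℚ.≤-trans (x≤ m n) (ℚ.+-monoʳ-≤ (x n) (ℚ.≤-trans
      (frac1-antimono (s≤s k≤n)) 1/k≤ε))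

open CauchySequences

infixl 6 _+_
infixl 7 _*_
infix  8 _⁻¹⟨_⟩

_+_ _*_ : ℝ → ℝ → ℝ
x + y = mkℝ (λ n → seq x n ℚ.+ seq y n) (+-cauchy x y)
x * y = mkℝ (λ n → seq x n ℚ.* seq y n) (*-cauchy x y)

∣_∣ : ℝ → ℝ
∣ x ∣ = mkℝ (λ n → ℚ.∣ seq x n ∣) (∣∣-cauchy x)

-- The proof of 0ℝ < x supplies a rational δ > 0 with δ ≤ seq x n for all
-- large n, so that the nth term is eventually just 1 / seq x n.
_⁻¹⟨_⟩ : (x : ℝ) → 0ℝ < x → ℝ
x ⁻¹⟨ (δ , 0<δ , N , δ≤) ⟩ = mkℝ (λ n → 1/⊔ 0<δ (seq x n)) (⁻¹-cauchy x 0<δ N δ≤)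

------------------------------------------------------------------------
-- Square roots and natural logarithms of natural numbers

isqrt : ℕ → ℕ
isqrt zero    = 0
isqrt (suc n) with suc (isqrt n) ℕ.* suc (isqrt n) ℕ.≤? suc n
... | yes _ = suc (isqrt n)
... | no  _ = isqrt n

isqrt-lower : ∀ n → isqrt n ℕ.* isqrt n ℕ.≤ n
isqrt-lower zero    = z≤n
isqrt-lower (suc n) with suc (isqrt n) ℕ.* suc (isqrt n) ℕ.≤? suc n
... | yes p = p
... | no  _ = ℕ.m≤n⇒m≤1+n (isqrt-lower n)

isqrt-upper : ∀ n → n ℕ.< suc (isqrt n) ℕ.* suc (isqrt n)
isqrt-upper zero    = s≤s z≤n
isqrt-upper (suc n) with suc (isqrt n) ℕ.* suc (isqrt n) ℕ.≤? suc n
... | yes _ = ℕ.≤-<-trans (isqrt-upper n)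
  (ℕ.*-mono-< {suc r} {suc (suc r)} {suc r} {suc (suc r)} ℕ.≤-refl ℕ.≤-refl)
  where
  r = isqrt n
... | no ¬p = ℕ.≰⇒> ¬p

-- With m = k + 1, the kth term is ⌊m√n⌋ / m.
sqrtSeq : ℕ → ℕ → ℚ
sqrtSeq n k = frac (isqrt (n ℕ.* (suc k ℕ.* suc k))) (suc k)

-- With m = k + 1, the kth term is the Riemann sum of ∫₁ⁿ dt/t with right
-- endpoints and step 1/m, whose ith summand is (1/m) · 1/(1 + i/m) = 1/(m + i)
-- for 1 ≤ i ≤ (n - 1) m.
logSeq : ℕ → ℕ → ℚ
logSeq n k = ∑ ((n ℕ.∸ 1) ℕ.* suc k) (λ i → frac 1 (suc k ℕ.+ suc i))

module Approximations where

  open ℚ.≤-Reasoning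

  sqrtSeq-≤ : ∀ n k l → sqrtSeq n k ℚ.≤ sqrtSeq n l ℚ.+ frac 1 (suc l)
  sqrtSeq-≤ n k l = subst (sqrtSeq n k ℚ.≤_) (frac-+ (s l) 1 (suc l))
    (frac-≤ {s k} {suc k} {s l ℕ.+ 1} {suc l}
      (subst (λ z → s k ℕ.* suc l ℕ.≤ z ℕ.* suc k) (ℕ.+-comm 1 (s l))
        (ℕ.≮⇒≥ λ lt → ℕ.<-irrefl refl (ℕ.<-≤-trans (ℕ.*-mono-< lt lt) (ℕ.<⇒≤ bound)))))
    where
    open ℕ-Solver.+-*-Solver using () renaming (solve to solveℕ; _:=_ to _:≡_; _:*_ to _:×_)
    s : ℕ → ℕ
    s k = isqrt (n ℕ.* (suc k ℕ.* suc k))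
    swap : ∀ a b → (a ℕ.* b) ℕ.* (a ℕ.* b) ≡ (a ℕ.* a) ℕ.* (b ℕ.* b)
    swap = solveℕ 2 (λ a b → (a :× b) :× (a :× b) :≡ (a :× a) :× (b :× b)) refl
    exchange : ∀ n a b → (n ℕ.* (b ℕ.* b)) ℕ.* (a ℕ.* a) ≡ (n ℕ.* (a ℕ.* a)) ℕ.* (b ℕ.* b)
    exchange = solveℕ 3 (λ n a b → (n :× (b :× b)) :× (a :× a) :≡ (n :× (a :× a)) :× (b :× b)) refl
    bound : (s k ℕ.* suc l) ℕ.* (s k ℕ.* suc l)
            ℕ.< (suc (s l) ℕ.* suc k) ℕ.* (suc (s l) ℕ.* suc k)
    bound = subst₂ ℕ._<_ (sym (swap (s k) (suc l))) (sym (swap (suc (s l)) (suc k)))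
      (ℕ.≤-<-trans (ℕ.*-monoˡ-≤ (suc l ℕ.* suc l) (isqrt-lower (n ℕ.* (suc k ℕ.* suc k))))
        (subst (ℕ._< (suc (s l) ℕ.* suc (s l)) ℕ.* (suc k ℕ.* suc k))
          (exchange n (suc k) (suc l))
          (ℕ.*-monoˡ-< (suc k ℕ.* suc k) (isqrt-upper (n ℕ.* (suc l ℕ.* suc l))))))

  module _ (n a b : ℕ) where

    private
      m k N : ℕ
      m = suc a
      k = suc b
      N = n ℕ.∸ 1

    refined : ℕ
    refined = b ℕ.+ a ℕ.* suc b

    private
      term : ℕ → ℕ → ℚ
      term i j = frac 1 (suc refined ℕ.+ suc (i ℕ.* k ℕ.+ j))

      unfold : logSeq n refined ≡ ∑ (N ℕ.* m) (λ i → ∑ k (term i))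
      unfold = trans (cong (λ z → ∑ z (λ i → frac 1 (suc refined ℕ.+ suc i)))
                           (sym (ℕ.*-assoc N m k)))
                     (∑-blocks (N ℕ.* m) k (λ i → frac 1 (suc refined ℕ.+ suc i)))

      block : ∀ d .{{_ : ℕ.NonZero d}} .{{_ : ℕ.NonZero (d ℕ.* k)}} →
              ∑ k (λ _ → frac 1 (d ℕ.* k)) ≡ frac 1 d
      block d = trans (∑-const k (d ℕ.* k)) (ℚ.≤-antisym
        (frac-≤ {k} {d ℕ.* k} {1} {d}
          (ℕ.≤-reflexive (trans (ℕ.*-comm k d) (sym (ℕ.*-identityˡ (d ℕ.* k))))))
        (frac-≤ {1} {d} {k} {d ℕ.* k}
          (ℕ.≤-reflexive (trans (ℕ.*-identityˡ (d ℕ.* k)) (ℕ.*-comm d k)))))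

      lower : ∀ i → frac 1 (m ℕ.+ suc i) ℚ.≤ ∑ k (term i)
      lower i = subst (ℚ._≤ ∑ k (term i)) (block (m ℕ.+ suc i)) (∑-mono k λ j j<k →
        frac1-antimono {suc refined ℕ.+ suc (i ℕ.* k ℕ.+ j)} {(m ℕ.+ suc i) ℕ.* k}
          (subst (suc refined ℕ.+ suc (i ℕ.* k ℕ.+ j) ℕ.≤_) (sym (ℕ.*-distribʳ-+ k m (suc i)))
            (ℕ.+-monoʳ-≤ (suc refined)
              (subst₂ ℕ._≤_ (ℕ.+-suc (i ℕ.* k) j) (ℕ.+-comm (i ℕ.* k) k)
                (ℕ.+-monoʳ-≤ (i ℕ.* k) j<k)))))

      upper : ∀ i → ∑ k (term i) ℚ.≤ frac 1 (m ℕ.+ i)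
      upper i = subst (∑ k (term i) ℚ.≤_) (block (m ℕ.+ i)) (∑-mono k λ j _ →
        frac1-antimono {(m ℕ.+ i) ℕ.* k} {suc refined ℕ.+ suc (i ℕ.* k ℕ.+ j)}
          (subst (ℕ._≤ suc refined ℕ.+ suc (i ℕ.* k ℕ.+ j)) (sym (ℕ.*-distribʳ-+ k m i))
            (ℕ.+-monoʳ-≤ (suc refined) (ℕ.m≤n⇒m≤1+n (ℕ.m≤m+n (i ℕ.* k) j)))))

      shift : ∀ c → ∑ c (λ i → frac 1 (m ℕ.+ i)) ℚ.+ frac 1 (m ℕ.+ c) ≡
                    ∑ c (λ i → frac 1 (m ℕ.+ suc i)) ℚ.+ frac 1 m
      shift zero    = cong (λ z → 0ℚ ℚ.+ frac 1 (suc z)) (ℕ.+-identityʳ a)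
      shift (suc c) = begin-equality
        L ℚ.+ q ℚ.+ r     ≡⟨ cong (ℚ._+ r) (shift c) ⟩
        R ℚ.+ t ℚ.+ r     ≡⟨ ring₂ R t r ⟩
        R ℚ.+ r ℚ.+ t     ∎
        where
        L R q r t : ℚ
        L = ∑ c (λ i → frac 1 (m ℕ.+ i))
        R = ∑ c (λ i → frac 1 (m ℕ.+ suc i))
        q = frac 1 (m ℕ.+ c)
        r = frac 1 (m ℕ.+ suc c)
        t = frac 1 m

    refine-≥ : logSeq n a ℚ.≤ logSeq n refined
    refine-≥ = subst (logSeq n a ℚ.≤_) (sym unfold) (∑-mono (N ℕ.* m) λ i _ → lower i)

    refine-≤ : logSeq n refined ℚ.≤ logSeq n a ℚ.+ frac 1 m
    refine-≤ = begin
      logSeq n refined                    ≡⟨ unfold ⟩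
      ∑ c (λ i → ∑ k (term i))            ≤⟨ ∑-mono c (λ i _ → upper i) ⟩
      L                                   ≡⟨ ℚ.+-identityʳ L ⟨
      L ℚ.+ 0ℚ                            ≤⟨ ℚ.+-monoʳ-≤ L (frac-nonNeg 1 (m ℕ.+ c)) ⟩
      L ℚ.+ frac 1 (m ℕ.+ c)              ≡⟨ shift c ⟩
      logSeq n a ℚ.+ frac 1 m             ∎
      where
      c = N ℕ.* m
      L = ∑ c (λ i → frac 1 (m ℕ.+ i))

  logSeq-≤ : ∀ n k l → logSeq n k ℚ.≤ logSeq n l ℚ.+ frac 1 (suc l)
  logSeq-≤ n k l = ℚ.≤-trans (refine-≥ n k l)
    (subst (λ z → logSeq n z ℚ.≤ logSeq n l ℚ.+ frac 1 (suc l))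
      (ℕ.suc-injective (ℕ.*-comm (suc l) (suc k))) (refine-≤ n l k))

open Approximations

√ : ℕ → ℝ
√ n = mkℝ (sqrtSeq n) (regular⇒cauchy (sqrtSeq n) (sqrtSeq-≤ n))

-- The value at 0 is irrelevant.
log : ℕ → ℝ
log n = mkℝ (logSeq n) (regular⇒cauchy (logSeq n) (logSeq-≤ n))

------------------------------------------------------------------------
-- The set of residue classes and its size

-- Δ p → ∞ as p → ∞ through the primes.  Only the values of Δ at primes matter.
TendsToInfinity : (ℕ → ℝ) → Set
TendsToInfinity Δ = ∀ (M : ℝ) → ∃[ P ] (∀ p → Prime p → P ℕ.≤ p → M ≤ Δ p)

-- { q y mod p : 1 ≤ q ≤ X, q prime, 1 ≤ y ≤ Y }, as a set of residue classes.
ProductResidues : (p : ℕ) .{{_ : ℕ.NonZero p}} (X Y : ℝ) → Pred (Fin p) 0ℓ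
ProductResidues p X Y r =
  ∃[ q ] ∃[ y ] ( (1 ℕ.≤ q × fromℕ q ≤ X × Prime q)
                × (1 ℕ.≤ y × fromℕ y ≤ Y)
                × (q ℕ.* y) mod p ≡ r )

-- Membership in ProductResidues p X Y is not decidable for arbitrary real X and
-- Y, so its cardinality cannot be computed.  Its size is instead expressed by
-- finite subsets A: A ⊑ S says that S contains the size of A many classes (at
-- least), A ≐ S that this is its exact cardinality.
infix 4 _⊑_ _≐_ _≃[1+O_∙_]_

_⊑_ _≐_ : ∀ {p} → Subset p → Pred (Fin p) 0ℓ → Set
A ⊑ S = ∀ r → r ∈ A → S r
A ≐ S = ∀ r → r ∈ A ⇔ S r

-- n = (1 + O(g)) p with implied constant C.
_≃[1+O_∙_]_ : ℕ → ℝ → ℝ → ℕ → Set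
n ≃[1+O C ∙ g ] p = ∃[ ε ] (∣ ε ∣ ≤ C * g × fromℕ n ≃ (1ℝ + ε) * fromℕ p)

{-# OPTIONS --safe #-}

-- Write x = ⌊√p⌋ and let d be an integer comparable to Δ(p).  For a set P of primes
-- up to x and I = P × [1, Y], let T = |I| and let E be the number of pairs in I × I
-- whose products agree mod p.  Bounding the variance of the number of representations
-- of a residue class from below on the missing classes, and using
-- p E ≤ T² + O(p T), shows that O(p² / T) classes are missing.
--
-- For distinct primes q, q′ ≤ x, the number of solutions of q y ≡ q′ y′ (mod p) in
-- [1, Y]² is at most (Y/q + 1)(q Y/p + 2), whose main term Y²/p is exactly the mean; the
-- error is harmless once the primes below |P|/2 are discarded.  Chebyshev's lower bound
-- for the number of primes up to x then makes T of order d p for Y ≍ d √p log p.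

module Submission where

-- The estimate is one-sided: no set of classes exceeds `p`, so it suffices to exhibit enough of
-- them, and each real bound may be replaced by a smaller natural number. All counting therefore
-- takes place in ℕ, with `q ≤ x` and `y ≤ d * x * j` for `j = floorLog 2 x`; the numbers `d`, `x`
-- and `j` lie below all late terms of the Cauchy sequences of Δ(p), √p and log p, so no comparison
-- of reals has to be decided. The obstacle is the rounding in (Y/q + 1)(q Y/p + 2). Multiplied by
-- p, this exceeds Y² by 2pY/q + qY + 2p. Over the |P| partners of q, the term 2pY/q adds up to
-- O(pY) only if q is not much smaller than |P|; this is why small primes are discarded, and at
-- least half of the primes survive. Inequalities that are naturally about differences are stated
-- with all terms added on one side or the other, since subtraction in ℕ truncates.

-- Finite sums and counting by injections.

module FiniteSums where

  open import Data.Bool.Base using (if_then_else_)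
  open import Data.Fin.Base using (Fin; zero; suc)
  open import Data.Fin.Properties using () renaming (_≟_ to _≟F_)
  open import Data.Fin.Subset using (Subset) renaming (∣_∣ to size)
  open import Data.List.Base using (List; []; _∷_; length; filter; allFin; tabulate; cartesianProduct; map; _++_)
  open import Data.List.Membership.Propositional using (_∈_; lose)
  open import Data.List.Membership.Propositional.Properties using (∈-allFin)
  import Data.List.Relation.Unary.All as All
  open import Data.List.Relation.Unary.AllPairs using ([]; _∷_)
  open import Data.List.Relation.Unary.Any using (any?; here; there)
  open import Data.List.Relation.Unary.Unique.Propositional using (Unique)
  open import Data.List.Relation.Unary.Unique.Propositional.Properties using (allFin⁺)
  open import Data.Nat.Base
  open import Data.Nat.Properties
  open import Data.Nat.Solver using (module +-*-Solver)
  open +-*-Solver using (solve; _:=_; _:+_; _:*_; con)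
  open import Data.Product.Base using (_×_; _,_)
  open import Data.Sum.Base using (inj₁; inj₂)
  import Data.Vec.Base as Vec
  open import Function.Base using (_∘_; id)
  open import Relation.Binary.Definitions using (DecidableEquality)
  open import Relation.Binary.PropositionalEquality
  open import Relation.Nullary using (Dec; yes; no; does; ¬_; contradiction; _×-dec_)
  open import Relation.Unary using (Decidable)

  private variable
    A B : Set
    P Q : Set

  ∑ : List A → (A → ℕ) → ℕ
  ∑ []       f = 0
  ∑ (x ∷ xs) f = f x + ∑ xs f

  ∑-mono : (xs : List A) {f g : A → ℕ} → (∀ {x} → x ∈ xs → f x ≤ g x) → ∑ xs f ≤ ∑ xs g
  ∑-mono []       f≤g = z≤n
  ∑-mono (x ∷ xs) f≤g = +-mono-≤ (f≤g (here refl)) (∑-mono xs (f≤g ∘ there))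

  ∑-cong : (xs : List A) {f g : A → ℕ} → (∀ {x} → x ∈ xs → f x ≡ g x) → ∑ xs f ≡ ∑ xs g
  ∑-cong []       f≡g = refl
  ∑-cong (x ∷ xs) f≡g = cong₂ _+_ (f≡g (here refl)) (∑-cong xs (f≡g ∘ there))

  ∑-const : (xs : List A) (c : ℕ) → ∑ xs (λ _ → c) ≡ length xs * c
  ∑-const []       c = refl
  ∑-const (x ∷ xs) c = cong (c +_) (∑-const xs c)

  ∑-zero : (xs : List A) → ∑ xs (λ _ → 0) ≡ 0
  ∑-zero xs = trans (∑-const xs 0) (*-zeroʳ (length xs))

  ∑-+ : (xs : List A) (f g : A → ℕ) → ∑ xs (λ x → f x + g x) ≡ ∑ xs f + ∑ xs g
  ∑-+ []       f g = refl
  ∑-+ (x ∷ xs) f g = trans (cong (f x + g x +_) (∑-+ xs f g))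
    (solve 4 (λ a b c d → a :+ b :+ (c :+ d) := a :+ c :+ (b :+ d)) refl (f x) (g x) (∑ xs f) (∑ xs g))

  ∑-*ˡ : (xs : List A) (c : ℕ) (f : A → ℕ) → ∑ xs (λ x → c * f x) ≡ c * ∑ xs f
  ∑-*ˡ []       c f = sym (*-zeroʳ c)
  ∑-*ˡ (x ∷ xs) c f = trans (cong (c * f x +_) (∑-*ˡ xs c f)) (sym (*-distribˡ-+ c (f x) _))

  ∑-*ʳ : (xs : List A) (c : ℕ) (f : A → ℕ) → ∑ xs (λ x → f x * c) ≡ ∑ xs f * c
  ∑-*ʳ xs c f = trans (∑-cong xs (λ {x} _ → *-comm (f x) c))
    (trans (∑-*ˡ xs c f) (*-comm c (∑ xs f)))

  ∑-swap : (xs : List A) (ys : List B) (f : A → B → ℕ) →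
           ∑ xs (λ x → ∑ ys (f x)) ≡ ∑ ys (λ y → ∑ xs (λ x → f x y))
  ∑-swap []       ys f = sym (∑-zero ys)
  ∑-swap (x ∷ xs) ys f = trans (cong (∑ ys (f x) +_) (∑-swap xs ys f))
    (sym (∑-+ ys (f x) (λ y → ∑ xs (λ x → f x y))))

  ∑-++ : (xs ys : List A) (f : A → ℕ) → ∑ (xs ++ ys) f ≡ ∑ xs f + ∑ ys f
  ∑-++ []       ys f = refl
  ∑-++ (x ∷ xs) ys f = trans (cong (f x +_) (∑-++ xs ys f)) (sym (+-assoc (f x) _ _))

  ∑-map : (h : A → B) (xs : List A) (f : B → ℕ) → ∑ (map h xs) f ≡ ∑ xs (f ∘ h)
  ∑-map h []       f = refl
  ∑-map h (x ∷ xs) f = cong (f (h x) +_) (∑-map h xs f)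

  ∑-cartesianProduct : (xs : List A) (ys : List B) (f : A × B → ℕ) →
    ∑ (cartesianProduct xs ys) f ≡ ∑ xs (λ x → ∑ ys (λ y → f (x , y)))
  ∑-cartesianProduct []       ys f = refl
  ∑-cartesianProduct (x ∷ xs) ys f = trans (∑-++ (map (x ,_) ys) _ f)
    (cong₂ _+_ (∑-map (x ,_) ys f) (∑-cartesianProduct xs ys f))

  length-cartesianProduct : (xs : List A) (ys : List B) →
    length (cartesianProduct xs ys) ≡ length xs * length ys
  length-cartesianProduct xs ys = trans (sym (trans (∑-const (cartesianProduct xs ys) 1) (*-identityʳ _)))
    (trans (∑-cartesianProduct xs ys (λ _ → 1))
    (trans (∑-const xs (∑ ys (λ _ → 1))) (cong (length xs *_) (trans (∑-const ys 1) (*-identityʳ _)))))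

  ∑-term : {xs : List A} (f : A → ℕ) {x : A} → x ∈ xs → f x ≤ ∑ xs f
  ∑-term f (here refl) = m≤m+n _ _
  ∑-term f (there x∈)  = ≤-trans (∑-term f x∈) (m≤n+m _ _)

  ⟦_⟧ : Dec P → ℕ
  ⟦ P? ⟧ = if does P? then 1 else 0

  ⟦⟧-true : (P? : Dec P) → P → ⟦ P? ⟧ ≡ 1
  ⟦⟧-true (yes _) p = refl
  ⟦⟧-true (no ¬p) p = contradiction p ¬p

  ⟦⟧-false : (P? : Dec P) → ¬ P → ⟦ P? ⟧ ≡ 0
  ⟦⟧-false (yes p) ¬p = contradiction p ¬p
  ⟦⟧-false (no _)  ¬p = refl

  ∑-sift : (_≟_ : DecidableEquality A) {xs : List A} → Unique xs →
           {v : A} → v ∈ xs → (f : A → ℕ) → ∑ xs (λ x → ⟦ v ≟ x ⟧ * f x) ≡ f v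
  ∑-sift _≟_ {x ∷ xs} (x∉ ∷ _) (here refl) f = begin
    ⟦ x ≟ x ⟧ * f x + ∑ xs (λ y → ⟦ x ≟ y ⟧ * f y)
      ≡⟨ cong₂ _+_ (cong (_* f x) (⟦⟧-true (x ≟ x) refl))
           (∑-cong xs λ y∈ → cong (_* f _) (⟦⟧-false (x ≟ _) (All.lookup x∉ y∈))) ⟩
    1 * f x + ∑ xs (λ _ → 0)
      ≡⟨ cong₂ _+_ (*-identityˡ (f x)) (∑-zero xs) ⟩
    f x + 0
      ≡⟨ +-identityʳ (f x) ⟩
    f x ∎
    where open ≡-Reasoning
  ∑-sift _≟_ {x ∷ xs} (x∉ ∷ u) {v} (there v∈) f = cong₂ _+_
    (cong (_* f x) (⟦⟧-false (v ≟ x) (λ v≡x → All.lookup x∉ v∈ (sym v≡x))))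
    (∑-sift _≟_ u v∈ f)

  ∑-at-most-one : {R : A → Set} (R? : Decidable R) {xs : List A} → Unique xs →
    (∀ {x y} → x ∈ xs → y ∈ xs → R x → R y → x ≡ y) → ∑ xs (λ x → ⟦ R? x ⟧) ≤ 1
  ∑-at-most-one R? {[]}     u        !R = z≤n
  ∑-at-most-one R? {x ∷ xs} (x∉ ∷ u) !R with R? x
  ... | no  _  = ∑-at-most-one R? u (λ y∈ z∈ → !R (there y∈) (there z∈))
  ... | yes Rx = s≤s (≤-reflexive (trans
    (∑-cong xs λ {y} y∈ → ⟦⟧-false (R? y) λ Ry → All.lookup x∉ y∈ (!R (here refl) (there y∈) Rx Ry))
    (∑-zero xs)))

  -- Double counting of the pairs (x, y) with `R x` and `κ x ≡ y`: every counted `x` has such a `y`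
  -- in `ys`, and every `y` has at most one such `x`. Injectivity of `κ` is asked only on solutions
  -- of `R`, which lets a congruence in `R` be used to prove it.
  ∑-pigeonhole : (_≟_ : DecidableEquality B) {R : A → Set} (R? : Decidable R)
    {xs : List A} → Unique xs → (ys : List B) (κ : A → B) →
    (∀ {x} → x ∈ xs → R x → κ x ∈ ys) →
    (∀ {x x′} → x ∈ xs → x′ ∈ xs → R x → R x′ → κ x ≡ κ x′ → x ≡ x′) →
    ∑ xs (λ x → ⟦ R? x ⟧) ≤ length ys
  ∑-pigeonhole _≟_ {R} R? {xs} u ys κ κ∈ κ-inj = begin
    ∑ xs (λ x → ⟦ R? x ⟧)
      ≤⟨ ∑-mono xs into ⟩
    ∑ xs (λ x → ∑ ys (λ y → ⟦ R? x ×-dec (κ x ≟ y) ⟧))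
      ≡⟨ ∑-swap xs ys _ ⟩
    ∑ ys (λ y → ∑ xs (λ x → ⟦ R? x ×-dec (κ x ≟ y) ⟧))
      ≤⟨ ∑-mono ys (λ {y} _ → ∑-at-most-one (λ x → R? x ×-dec (κ x ≟ y)) u
           λ x∈ x′∈ (Rx , κx≡y) (Rx′ , κx′≡y) → κ-inj x∈ x′∈ Rx Rx′ (trans κx≡y (sym κx′≡y))) ⟩
    ∑ ys (λ _ → 1)
      ≡⟨ trans (∑-const ys 1) (*-identityʳ _) ⟩
    length ys ∎
    where
    open ≤-Reasoning
    into : ∀ {x} → x ∈ xs → ⟦ R? x ⟧ ≤ ∑ ys (λ y → ⟦ R? x ×-dec (κ x ≟ y) ⟧)
    into {x} x∈ with R? x
    ... | no  _  = z≤n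
    ... | yes Rx = ≤-trans (≤-reflexive (sym (⟦⟧-true (κ x ≟ κ x) refl)))
      (∑-term (λ y → ⟦ yes Rx ×-dec (κ x ≟ y) ⟧) (κ∈ x∈ Rx))

  length-filter≡∑ : {R : A → Set} (R? : Decidable R) (xs : List A) →
    length (filter R? xs) ≡ ∑ xs (λ x → ⟦ R? x ⟧)
  length-filter≡∑ R? []       = refl
  length-filter≡∑ R? (x ∷ xs) with R? x
  ... | yes _ = cong suc (length-filter≡∑ R? xs)
  ... | no  _ = length-filter≡∑ R? xs

  2ab≤a²+b² : ∀ a b → 2 * (a * b) ≤ a * a + b * b
  2ab≤a²+b² a b with ≤-total a b
  ... | inj₁ a≤b = lemma a (b ∸ a) (m+[n∸m]≡n a≤b)
    where
    lemma : ∀ a c {b} → a + c ≡ b → 2 * (a * b) ≤ a * a + b * b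
    lemma a c refl = ≤-trans (m≤m+n _ (c * c)) (≤-reflexive
      (solve 2 (λ a c → con 2 :* (a :* (a :+ c)) :+ c :* c := a :* a :+ (a :+ c) :* (a :+ c)) refl a c))
  ... | inj₂ b≤a = lemma b (a ∸ b) (m+[n∸m]≡n b≤a)
    where
    lemma : ∀ b c {a} → b + c ≡ a → 2 * (a * b) ≤ a * a + b * b
    lemma b c refl = ≤-trans (m≤m+n _ (c * c)) (≤-reflexive
      (solve 2 (λ b c → con 2 :* ((b :+ c) :* b) :+ c :* c := (b :+ c) :* (b :+ c) :+ b :* b) refl b c))

  -- Second moment of the number of representations.

  module _ {p : ℕ} (I : List A) (g : A → Fin p) where

    image : Subset p
    image = Vec.tabulate λ r → does (any? (λ i → g i ≟F r) I)

    -- The sum of `N r * N r` over all classes, unfolded into pairs so that it can be bounded by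
    -- counting congruences.
    collisions : ℕ
    collisions = ∑ I λ i → ∑ I λ j → ⟦ g j ≟F g i ⟧

    private
      T = length I
      hit? = λ r → any? (λ i → g i ≟F r) I

      N : Fin p → ℕ
      N r = ∑ I λ i → ⟦ g i ≟F r ⟧

      size-tabulate : ∀ {n} {R : Fin n → Set} (R? : Decidable R) →
        size (Vec.tabulate (does ∘ R?)) ≡ ∑ (allFin n) (λ r → ⟦ R? r ⟧)
      size-tabulate R? = lemma R? id
        where
        lemma : ∀ {m n} {R : Fin m → Set} (R? : Decidable R) (f : Fin n → Fin m) →
                size (Vec.tabulate (does ∘ R? ∘ f)) ≡ ∑ (tabulate f) (λ r → ⟦ R? r ⟧)
        lemma {n = zero}  R? f = refl
        lemma {n = suc n} R? f with R? (f zero)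
        ... | yes _ = cong suc (lemma R? (f ∘ suc))
        ... | no  _ = lemma R? (f ∘ suc)

      -- Used twice: `h = 1` gives the total `T`, and `h = N` gives `collisions`.
      ∑N* : (h : Fin p → ℕ) → ∑ (allFin p) (λ r → N r * h r) ≡ ∑ I (h ∘ g)
      ∑N* h = begin
        ∑ (allFin p) (λ r → N r * h r)
          ≡⟨ ∑-cong (allFin p) (λ {r} _ → sym (∑-*ʳ I (h r) _)) ⟩
        ∑ (allFin p) (λ r → ∑ I (λ i → ⟦ g i ≟F r ⟧ * h r))
          ≡⟨ ∑-swap (allFin p) I _ ⟩
        ∑ I (λ i → ∑ (allFin p) (λ r → ⟦ g i ≟F r ⟧ * h r))
          ≡⟨ ∑-cong I (λ {i} _ → ∑-sift _≟F_ (allFin⁺ p) (∈-allFin (g i)) h) ⟩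
        ∑ I (h ∘ g) ∎
        where open ≡-Reasoning

      -- On a class that is hit this is (p N(r) - T)² ≥ 0. On a missed class the left side vanishes,
      -- so the summand T² can be left out; that saving is what detects missing classes.
      pointwise : ∀ r → 2 * (p * T) * (N r * 1) ≤ p * p * (N r * N r) + T * T * ⟦ hit? r ⟧
      pointwise r with hit? r
      ... | yes _ = begin
        2 * (p * T) * (N r * 1)             ≡⟨ solve 3 (λ p t n → con 2 :* (p :* t) :* (n :* con 1) := con 2 :* (p :* n :* t)) refl p T (N r) ⟩
        2 * (p * N r * T)                   ≤⟨ 2ab≤a²+b² (p * N r) T ⟩
        p * N r * (p * N r) + T * T         ≡⟨ solve 3 (λ p t n → p :* n :* (p :* n) :+ t :* t := p :* p :* (n :* n) :+ t :* t :* con 1) refl p T (N r) ⟩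
        p * p * (N r * N r) + T * T * 1     ∎
        where open ≤-Reasoning
      ... | no ¬hit = ≤-trans (≤-reflexive (trans (cong (λ n → 2 * (p * T) * (n * 1)) N≡0) (*-zeroʳ (2 * (p * T))))) z≤n
        where
        N≡0 : N r ≡ 0
        N≡0 = trans (∑-cong I λ {i} i∈ → ⟦⟧-false (g i ≟F r) λ e → ¬hit (lose i∈ e)) (∑-zero I)

    -- Each missed class contributes T² to the sum of (p N(r) - T)² over all r, which equals p² E -
    -- 2pT² + pT² for E the number of collisions. The inequality is this remark with the negative
    -- terms moved across.
    second-moment : 2 * (p * T) * T ≤ p * p * collisions + T * T * size image
    second-moment = begin
      2 * (p * T) * T
        ≡⟨ cong (2 * (p * T) *_) (*-identityʳ T) ⟨
      2 * (p * T) * (T * 1)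
        ≡⟨ cong (2 * (p * T) *_) (trans (∑N* (λ _ → 1)) (∑-const I 1)) ⟨
      2 * (p * T) * ∑ (allFin p) (λ r → N r * 1)
        ≡⟨ ∑-*ˡ (allFin p) (2 * (p * T)) (λ r → N r * 1) ⟨
      ∑ (allFin p) (λ r → 2 * (p * T) * (N r * 1))
        ≤⟨ ∑-mono (allFin p) (λ {r} _ → pointwise r) ⟩
      ∑ (allFin p) (λ r → p * p * (N r * N r) + T * T * ⟦ hit? r ⟧)
        ≡⟨ ∑-+ (allFin p) _ _ ⟩
      ∑ (allFin p) (λ r → p * p * (N r * N r)) + ∑ (allFin p) (λ r → T * T * ⟦ hit? r ⟧)
        ≡⟨ cong₂ _+_ (∑-*ˡ (allFin p) (p * p) (λ r → N r * N r)) (∑-*ˡ (allFin p) (T * T) (λ r → ⟦ hit? r ⟧)) ⟩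
      p * p * ∑ (allFin p) (λ r → N r * N r) + T * T * ∑ (allFin p) (λ r → ⟦ hit? r ⟧)
        ≡⟨ cong₂ (λ a b → p * p * a + T * T * b) (∑N* N) (sym (size-tabulate hit?)) ⟩
      p * p * collisions + T * T * size image ∎
      where open ≤-Reasoning

-- Chebyshev's lower bound for the number of primes.

module Chebyshev where

  open import Data.List.Base using (List; []; _∷_; length; filter; upTo; map)
  open import Data.List.Membership.Propositional using (_∈_)
  open import Data.List.Membership.Propositional.Properties using (∈-filter⁺; ∈-filter⁻; ∈-upTo⁺)
  open import Data.List.Relation.Unary.All as All using (All; []; _∷_)
  open import Data.List.Relation.Unary.Any using (here; there)
  open import Data.Nat.Base
  open import Data.Nat.Combinatorics using (_C_; nC1≡n; nCk+nC[k+1]≡[n+1]C[k+1])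
  open import Data.Nat.Divisibility
  open import Data.Nat.Induction using (<-wellFounded)
  open import Data.Nat.ListAction using (product)
  open import Data.Nat.Primality
  open import Data.Nat.Primality.Factorisation using (factorise)
  open import Data.Nat.Properties
  open import Data.Nat.Solver using (module +-*-Solver)
  open +-*-Solver using (solve; _:=_; _:+_; _:*_; con)
  open import Data.Product.Base using (_×_; _,_; ∃-syntax; proj₂)
  open import Induction.WellFounded using (Acc; acc)
  open import Relation.Binary.PropositionalEquality
  open import Relation.Nullary using (yes; no; ¬_; contradiction)

  floorLog : ℕ → ℕ → ℕ
  floorLog b zero    = 0
  floorLog b (suc n) with b ^ suc (floorLog b n) ≤? suc n
  ... | yes _ = suc (floorLog b n)
  ... | no  _ = floorLog b n

  b^floorLog≤n : ∀ b n .{{_ : NonZero n}} → b ^ floorLog b n ≤ n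
  b^floorLog≤n b (suc n) with b ^ suc (floorLog b n) ≤? suc n
  ... | yes p = p
  ... | no _ with n
  ...   | zero    = ≤-refl
  ...   | suc n-1 = m≤n⇒m≤1+n (b^floorLog≤n b (suc n-1))

  n<b^1+floorLog : ∀ b n → 2 ≤ b → n < b ^ suc (floorLog b n)
  n<b^1+floorLog b zero 2≤b = ≤-trans (s≤s z≤n) (≤-trans 2≤b (≤-reflexive (sym (*-identityʳ b))))
  n<b^1+floorLog b (suc n) 2≤b with b ^ suc (floorLog b n) ≤? suc n
  ... | no ¬p = ≰⇒> ¬p
  ... | yes p = begin-strict
    suc n                    ≤⟨ n<b^1+floorLog b n 2≤b ⟩
    c                        <⟨ m<m+n c (≤-trans (s≤s z≤n) (n<b^1+floorLog b n 2≤b)) ⟩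
    c + c                    ≡⟨ cong (c +_) (sym (+-identityʳ c)) ⟩
    2 * c                    ≤⟨ *-monoˡ-≤ c 2≤b ⟩
    b * c                    ∎
    where
    open ≤-Reasoning
    c = b ^ suc (floorLog b n)

  [k+1]*[n+1]C[k+1] : ∀ n k → suc k * (suc n C suc k) ≡ suc n * (n C k)
  [k+1]*[n+1]C[k+1] n zero = trans (*-identityˡ _) (trans (nC1≡n (suc n)) (sym (*-identityʳ (suc n))))
  [k+1]*[n+1]C[k+1] zero (suc k) = *-zeroʳ (suc (suc k))
  [k+1]*[n+1]C[k+1] (suc n) (suc k) = begin
    (2 + k) * ((2 + n) C (2 + k))
      ≡⟨ cong ((2 + k) *_) (sym (nCk+nC[k+1]≡[n+1]C[k+1] (suc n) (suc k))) ⟩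
    (2 + k) * (u + v)
      ≡⟨ solve 3 (λ k u v → (con 2 :+ k) :* (u :+ v) := u :+ ((con 1 :+ k) :* u :+ (con 2 :+ k) :* v)) refl k u v ⟩
    u + (suc k * u + (2 + k) * v)
      ≡⟨ cong₂ (λ a b → u + (a + b)) ([k+1]*[n+1]C[k+1] n k) ([k+1]*[n+1]C[k+1] n (suc k)) ⟩
    u + (suc n * (n C k) + suc n * (n C suc k))
      ≡⟨ cong (u +_) (sym (*-distribˡ-+ (suc n) (n C k) (n C suc k))) ⟩
    u + suc n * (n C k + n C suc k)
      ≡⟨ cong (λ a → u + suc n * a) (nCk+nC[k+1]≡[n+1]C[k+1] n k) ⟩
    (2 + n) * u ∎
    where
    open ≡-Reasoning
    u = suc n C suc k
    v = suc n C (2 + k)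

  [k+1]*nC[k+1]+k*nCk : ∀ n k → suc k * (n C suc k) + k * (n C k) ≡ n * (n C k)
  [k+1]*nC[k+1]+k*nCk n k = +-cancelˡ-≡ w _ _ (begin
    w + (suc k * u + k * w)     ≡⟨ solve 3 (λ k u w → w :+ ((con 1 :+ k) :* u :+ k :* w) := (con 1 :+ k) :* (w :+ u)) refl k u w ⟩
    suc k * (w + u)             ≡⟨ cong (suc k *_) (nCk+nC[k+1]≡[n+1]C[k+1] n k) ⟩
    suc k * (suc n C suc k)     ≡⟨ [k+1]*[n+1]C[k+1] n k ⟩
    suc n * w                   ∎)
    where
    open ≡-Reasoning
    u = n C suc k
    w = n C k

  -- The entries 1 / ((m + 1) C(m, k)) of Leibniz's harmonic triangle satisfy
  -- ℓ(m + 1, k + 1) = ℓ(m, k) - ℓ(m + 1, k), so D ℓ(m, k) is an integer for all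
  -- k as soon as it is one for k = 0.
  leibniz-∣ : ∀ {N D} → (∀ i → 1 ≤ i → i ≤ N → i ∣ D) →
              ∀ m k → m < N → k ≤ m → suc m * (m C k) ∣ D
  leibniz-∣ {N} {D} i∣D m zero m<N _ = subst (_∣ D) (sym (*-identityʳ (suc m))) (i∣D (suc m) (s≤s z≤n) m<N)
  leibniz-∣ {N} {D} i∣D (suc m) (suc k) m<N (s≤s k≤m)
    with leibniz-∣ {N} {D} i∣D m k (<-trans (n<1+n m) m<N) k≤m | leibniz-∣ {N} {D} i∣D (suc m) k m<N (m≤n⇒m≤1+n k≤m)
  ... | divides x D≡xa | divides y D≡yb =
    ∣m+n∣m⇒∣n (subst (c ∣_) cx≡cy+D (m∣m*n x)) (m∣m*n y)
    where
    open ≡-Reasoning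
    u = suc m C suc k
    w = suc m C k
    c = suc (suc m) * u
    D≡x[k+1]u : x * (suc k * u) ≡ D
    D≡x[k+1]u = trans (cong (x *_) ([k+1]*[n+1]C[k+1] m k)) (sym D≡xa)
    -- Here `x` is D ℓ(m, k) and `y` is D ℓ(m + 1, k), so D / c = x - y. Multiplying by `suc k` and
    -- adding `k * D` allows both hypotheses on D to be substituted without division or subtraction.
    cx≡cy+D : c * x ≡ c * y + D
    cx≡cy+D = *-cancelˡ-≡ _ _ (suc k) (+-cancelˡ-≡ (k * D) _ _ (begin
      k * D + suc k * (c * x)
        ≡⟨ cong (k * D +_) (solve 4 (λ k m u x → (con 1 :+ k) :* ((con 2 :+ m) :* u :* x) := (con 2 :+ m) :* (x :* ((con 1 :+ k) :* u))) refl k m u x) ⟩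
      k * D + (2 + m) * (x * (suc k * u))
        ≡⟨ cong (λ z → k * D + (2 + m) * z) D≡x[k+1]u ⟩
      k * D + (2 + m) * D
        ≡⟨ solve 3 (λ k m D → k :* D :+ (con 2 :+ m) :* D := (con 1 :+ k) :* D :+ (con 1 :+ m) :* D) refl k m D ⟩
      suc k * D + suc m * D
        ≡⟨ cong (λ z → suc k * D + suc m * z) D≡yb ⟩
      suc k * D + suc m * (y * ((2 + m) * w))
        ≡⟨ cong (suc k * D +_) (solve 3 (λ m w y → (con 1 :+ m) :* (y :* ((con 2 :+ m) :* w)) := (con 2 :+ m) :* y :* ((con 1 :+ m) :* w)) refl m w y) ⟩
      suc k * D + (2 + m) * y * (suc m * w)
        ≡⟨ cong (λ z → suc k * D + (2 + m) * y * z) (sym ([k+1]*nC[k+1]+k*nCk (suc m) k)) ⟩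
      suc k * D + (2 + m) * y * (suc k * u + k * w)
        ≡⟨ solve 6 (λ k m u w y D → (con 1 :+ k) :* D :+ (con 2 :+ m) :* y :* ((con 1 :+ k) :* u :+ k :* w)
             := k :* (y :* ((con 2 :+ m) :* w)) :+ (con 1 :+ k) :* ((con 2 :+ m) :* u :* y :+ D)) refl k m u w y D ⟩
      k * (y * ((2 + m) * w)) + suc k * (c * y + D)
        ≡⟨ cong (λ z → k * z + suc k * (c * y + D)) D≡yb ⟨
      k * D + suc k * (c * y + D) ∎))

  nCk≤[n+1]Ck : ∀ n k → n C k ≤ suc n C k
  nCk≤[n+1]Ck n zero    = ≤-refl
  nCk≤[n+1]Ck n (suc k) = ≤-trans (m≤n+m _ (n C k)) (≤-reflexive (nCk+nC[k+1]≡[n+1]C[k+1] n k))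

  -- Both Pascal summands of C(2n + 2, n + 1) are at least C(2n, n). The true order is about 4^n;
  -- the weaker base only affects the constant.
  2^n≤2nCn : ∀ n → 2 ^ n ≤ (n + n) C n
  2^n≤2nCn zero    = ≤-refl
  2^n≤2nCn (suc n) = begin
    2 * 2 ^ n                                   ≤⟨ *-monoʳ-≤ 2 (2^n≤2nCn n) ⟩
    2 * c                                       ≡⟨ cong (c +_) (+-identityʳ c) ⟩
    c + c                                       ≤⟨ +-mono-≤ (nCk≤[n+1]Ck (n + n) n) (≤-trans (m≤m+n c _) (≤-reflexive (nCk+nC[k+1]≡[n+1]C[k+1] (n + n) n))) ⟩
    suc (n + n) C n + suc (n + n) C suc n       ≡⟨ nCk+nC[k+1]≡[n+1]C[k+1] (suc (n + n)) n ⟩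
    suc (suc (n + n)) C suc n                   ≡⟨ cong (_C suc n) (cong suc (sym (+-suc n n))) ⟩
    (suc n + suc n) C suc n                     ∎
    where
    open ≤-Reasoning
    c = (n + n) C n

  split-power : ∀ q → 2 ≤ q → ∀ m .{{_ : NonZero m}} → ∃[ a ] ∃[ m′ ] (m ≡ q ^ a * m′ × ¬ q ∣ m′)
  split-power q 2≤q m = go m (<-wellFounded m)
    where
    go : ∀ m .{{_ : NonZero m}} → Acc _<_ m → ∃[ a ] ∃[ m′ ] (m ≡ q ^ a * m′ × ¬ q ∣ m′)
    go m (acc rs) with q ∣? m
    ... | no  q∤m = 0 , m , sym (+-identityʳ m) , q∤m
    ... | yes q∣m@(divides (suc n) refl)
      with go (suc n) (rs (m<m*n (suc n) q 2≤q))
    ... | a , m′ , n≡ , q∤m′ = suc a , m′ ,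
      trans (cong (_* q) n≡) (trans (*-comm (q ^ a * m′) q) (sym (*-assoc q (q ^ a) m′))) , q∤m′

  ^-monoʳ-∣ : ∀ q {a b} → a ≤ b → q ^ a ∣ q ^ b
  ^-monoʳ-∣ q {a} {b} a≤b = subst (q ^ a ∣_)
    (trans (sym (^-distribˡ-+-* q a (b ∸ a))) (cong (q ^_) (m+[n∸m]≡n a≤b))) (m∣m*n (q ^ (b ∸ a)))

  -- For ps the primes up to N this is lcm(1, …, N).
  largestPowers : ℕ → List ℕ → ℕ
  largestPowers N ps = product (map (λ q → q ^ floorLog q N) ps)

  prime⇒2≤ : ∀ {q} → Prime q → 2 ≤ q
  prime⇒2≤ {q} q-prime = nonTrivial⇒n>1 q {{prime⇒nonTrivial q-prime}}

  -- The primes of `ps` are stripped off one at a time: q^a ≤ m ≤ N bounds the exponent by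
  -- `floorLog q N`, and the cofactor has its prime factors in the rest of the list. Once the list
  -- is empty, m has no prime factor and equals 1.
  ∣largestPowers : ∀ {N ps} → All Prime ps → ∀ m .{{_ : NonZero m}} → m ≤ N →
    (∀ q → Prime q → q ∣ m → q ∈ ps) → m ∣ largestPowers N ps
  ∣largestPowers {N} {[]} [] m m≤N ⊆ps with factorise m
  ... | record { factors = []; isFactorisation = m≡1 } = divides 1 (sym (trans (*-identityˡ m) m≡1))
  ... | record { factors = q ∷ qs; isFactorisation = m≡; factorsPrime = q-prime ∷ _ } =
    contradiction (⊆ps q q-prime (subst (q ∣_) (sym m≡) (m∣m*n (product qs)))) λ ()
  ∣largestPowers {N} {q ∷ ps} (q-prime ∷ ps-prime) m m≤N ⊆ps
    with split-power q (prime⇒2≤ q-prime) m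
  ... | a , m′ , refl , q∤m′ = *-pres-∣ (^-monoʳ-∣ q a≤)
    (∣largestPowers ps-prime m′ {{m*n≢0⇒n≢0 (q ^ a)}}
      (≤-trans (m≤n*m m′ (q ^ a) {{m*n≢0⇒m≢0 (q ^ a)}}) m≤N) ⊆ps′)
    where
    a≤ : a ≤ floorLog q N
    a≤ = ≮⇒≥ λ lt → <-irrefl refl (begin-strict
      q ^ a                     ≤⟨ m≤m*n (q ^ a) m′ {{m*n≢0⇒n≢0 (q ^ a)}} ⟩
      q ^ a * m′                ≤⟨ m≤N ⟩
      N                         <⟨ n<b^1+floorLog q N (prime⇒2≤ q-prime) ⟩
      q ^ suc (floorLog q N)    ≤⟨ ^-monoʳ-≤ q {{prime⇒nonZero q-prime}} lt ⟩
      q ^ a                     ∎)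
      where open ≤-Reasoning
    ⊆ps′ : ∀ r → Prime r → r ∣ m′ → r ∈ ps
    ⊆ps′ r r-prime r∣m′ with ⊆ps r r-prime (∣n⇒∣m*n (q ^ a) r∣m′)
    ... | here refl = contradiction r∣m′ q∤m′
    ... | there r∈  = r∈

  largestPowers≤ : ∀ N .{{_ : NonZero N}} ps → largestPowers N ps ≤ N ^ length ps
  largestPowers≤ N []       = ≤-refl
  largestPowers≤ N (q ∷ ps) = *-mono-≤ (b^floorLog≤n q N) (largestPowers≤ N ps)

  largestPowers≢0 : ∀ {N ps} → All Prime ps → NonZero (largestPowers N ps)
  largestPowers≢0 []                            = _
  largestPowers≢0 {N} {q ∷ ps} (q-prime ∷ ps-prime) =
    m*n≢0 _ _ {{m^n≢0 q (floorLog q N) {{prime⇒nonZero q-prime}}}} {{largestPowers≢0 {N} ps-prime}}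

  primesUpTo : ℕ → List ℕ
  primesUpTo N = filter prime? (upTo (suc N))

  primesUpTo-prime : ∀ N → All Prime (primesUpTo N)
  primesUpTo-prime N = All.tabulate λ q∈ → proj₂ (∈-filter⁻ prime? {xs = upTo (suc N)} q∈)

  -- The middle entry (2n + 1) C(2n, n) of the Leibniz triangle divides lcm(1, ..., N), to which
  -- each prime contributes a power of at most N.
  chebyshev : ∀ n N → suc (n + n) ≤ N → 2 ^ n ≤ N ^ length (primesUpTo N)
  chebyshev n N 2n<N = begin
    2 ^ n                                ≤⟨ 2^n≤2nCn n ⟩
    (n + n) C n                          ≤⟨ m≤n*m ((n + n) C n) (suc (n + n)) ⟩
    suc (n + n) * ((n + n) C n)          ≤⟨ ∣⇒≤ {{largestPowers≢0 {N} (primesUpTo-prime N)}} (leibniz-∣ i∣ (n + n) n 2n<N (m≤m+n n n)) ⟩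
    largestPowers N (primesUpTo N)       ≤⟨ largestPowers≤ N {{>-nonZero (≤-trans (s≤s z≤n) 2n<N)}} (primesUpTo N) ⟩
    N ^ length (primesUpTo N)            ∎
    where
    open ≤-Reasoning
    i∣ : ∀ i → 1 ≤ i → i ≤ N → i ∣ largestPowers N (primesUpTo N)
    i∣ i 1≤i i≤N = ∣largestPowers (primesUpTo-prime N) i i≤N λ q q-prime q∣i →
      ∈-filter⁺ prime? (∈-upTo⁺ (s≤s (≤-trans (∣⇒≤ q∣i) i≤N))) q-prime
      where instance _ = >-nonZero 1≤i

-- Counting solutions of q y ≡ q′ y′ modulo p.

module ProductResidueCount where

  open FiniteSums
  open Chebyshev using (floorLog; n<b^1+floorLog; primesUpTo; chebyshev)

  open import Data.Fin.Base using (Fin; toℕ)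
  open import Data.Fin.Properties using (toℕ-fromℕ<) renaming (_≟_ to _≟F_)
  open import Data.Fin.Subset using (Subset) renaming (_∈_ to _∈ˢ_; ∣_∣ to size)
  open import Data.List.Base using (List; []; _∷_; length; filter; upTo; cartesianProduct)
  open import Data.List.Membership.Propositional using (_∈_; find)
  open import Data.List.Membership.Propositional.Properties
    using (∈-filter⁻; ∈-upTo⁺; ∈-upTo⁻; ∈-cartesianProduct⁺; ∈-cartesianProduct⁻)
  open import Data.List.Properties using (length-upTo)
  open import Data.List.Relation.Unary.Any using (any?; here)
  open import Data.List.Relation.Unary.Unique.Propositional using (Unique)
  open import Data.List.Relation.Unary.Unique.Propositional.Properties using (upTo⁺; cartesianProduct⁺; filter⁺)
  open import Data.Nat.Base
  open import Data.Nat.Coprimality using (Coprime; coprime-divisor; prime⇒coprime) renaming (sym to coprime-sym)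
  open import Data.Nat.Divisibility
  open import Data.Nat.DivMod
  open import Data.Nat.Primality
  open import Data.Nat.Properties
  open import Data.Nat.Solver using (module +-*-Solver)
  open +-*-Solver using (solve; _:=_; _:+_; _:*_; con)
  open import Data.Product.Base using (_×_; _,_; ∃-syntax; proj₁; proj₂)
  open import Data.Product.Properties using (≡-dec; ,-injective)
  open import Data.Sum.Base using (inj₁; inj₂; [_,_]′)
  open import Data.Vec.Properties using (lookup∘tabulate; []=⇒lookup)
  open import Function.Base using (_∘_)
  open import Relation.Binary.Definitions using (tri<; tri≈; tri>)
  open import Relation.Binary.PropositionalEquality
  open import Relation.Nullary using (Dec; yes; no; does; ¬_; contradiction; ¬?)
  open import Relation.Unary using (Decidable)

  m%p≡[m+k]%p⇒p∣k : ∀ {p} .{{_ : NonZero p}} m k → m % p ≡ (m + k) % p → p ∣ k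
  m%p≡[m+k]%p⇒p∣k {p} m k eq = ∣m+n∣m⇒∣n {m = m / p * p}
    (divides ((m + k) / p) (+-cancelˡ-≡ (m % p) _ _ (begin
      m % p + (m / p * p + k)              ≡⟨ +-assoc (m % p) _ k ⟨
      m % p + m / p * p + k                ≡⟨ cong (_+ k) (m≡m%n+[m/n]*n m p) ⟨
      m + k                                ≡⟨ m≡m%n+[m/n]*n (m + k) p ⟩
      (m + k) % p + (m + k) / p * p        ≡⟨ cong (_+ (m + k) / p * p) eq ⟨
      m % p + (m + k) / p * p              ∎)))
    (n∣m*n (m / p))
    where open ≡-Reasoning

  m∣n⇒n<m⇒n≡0 : ∀ {m n} → m ∣ n → n < m → n ≡ 0
  m∣n⇒n<m⇒n≡0 {n = zero}  m∣n n<m = refl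
  m∣n⇒n<m⇒n≡0 {n = suc _} m∣n n<m = contradiction (∣⇒≤ m∣n) (<⇒≱ n<m)

  m%p-cancelˡ : ∀ {p} .{{_ : NonZero p}} q {a b} → Coprime p q → a ≤ b → b ∸ a < p →
    (q * a) % p ≡ (q * b) % p → a ≡ b
  m%p-cancelˡ {p} q {a} {b} coprime a≤b b-a<p eq =
    ≤-antisym a≤b (m∸n≡0⇒m≤n (m∣n⇒n<m⇒n≡0 p∣b-a b-a<p))
    where
    p∣b-a : p ∣ b ∸ a
    p∣b-a = coprime-divisor coprime (m%p≡[m+k]%p⇒p∣k (q * a) (q * (b ∸ a)) (trans eq
      (cong (_% p) (trans (cong (q *_) (sym (m+[n∸m]≡n a≤b))) (*-distribˡ-+ q a (b ∸ a))))))

  -- Collecting terms shows that q divides q′ (t′ - t), hence t′ - t, which is smaller than q.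
  linear-form-injective : ∀ {q q′ y y′ t t′} .{{_ : NonZero q}} → Coprime q q′ → t ≤ t′ → t′ ∸ t < q →
    q * y + q′ * t ≡ q * y′ + q′ * t′ → t ≡ t′ × y ≡ y′
  linear-form-injective {q} {q′} {y} {y′} {t} {t′} coprime t≤t′ lt eq = t≡t′ , *-cancelˡ-≡ y y′ q qy≡qy′
    where
    open ≡-Reasoning
    qy≡ : q * y ≡ q * y′ + q′ * (t′ ∸ t)
    qy≡ = +-cancelʳ-≡ (q′ * t) _ _ (begin
      q * y + q′ * t                          ≡⟨ eq ⟩
      q * y′ + q′ * t′                        ≡⟨ cong (λ z → q * y′ + q′ * z) (m∸n+n≡m t≤t′) ⟨
      q * y′ + q′ * (t′ ∸ t + t)              ≡⟨ cong (q * y′ +_) (*-distribˡ-+ q′ (t′ ∸ t) t) ⟩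
      q * y′ + (q′ * (t′ ∸ t) + q′ * t)       ≡⟨ +-assoc (q * y′) _ _ ⟨
      q * y′ + q′ * (t′ ∸ t) + q′ * t         ∎)
    q∣t′-t : q ∣ t′ ∸ t
    q∣t′-t = coprime-divisor coprime (∣m+n∣m⇒∣n (subst (q ∣_) qy≡ (m∣m*n y)) (m∣m*n y′))
    t≡t′ : t ≡ t′
    t≡t′ = ≤-antisym t≤t′ (m∸n≡0⇒m≤n (m∣n⇒n<m⇒n≡0 q∣t′-t lt))
    qy≡qy′ : q * y ≡ q * y′
    qy≡qy′ = +-cancelʳ-≡ (q′ * t) _ _ (trans eq (cong (λ z → q * y′ + q′ * z) (sym t≡t′)))

  module _ {p : ℕ} .{{_ : NonZero p}} where

    private
      toℕ-mod : ∀ a → toℕ (a mod p) ≡ a % p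
      toℕ-mod a = toℕ-fromℕ< (m%n<n a p)

    mod≡⇒%≡ : ∀ {a b} → a mod p ≡ b mod p → a % p ≡ b % p
    mod≡⇒%≡ {a} {b} eq = trans (sym (toℕ-mod a)) (trans (cong toℕ eq) (toℕ-mod b))

    -- The second coordinate is one less than the factor it stands for, so `upTo Y` enumerates the
    -- factors 1, ..., Y.
    product-residue : ℕ × ℕ → Fin p
    product-residue (q , y) = (q * suc y) mod p

    congruent? : ∀ q q′ ((y , y′) : ℕ × ℕ) →
      Dec (product-residue (q′ , y′) ≡ product-residue (q , y))
    congruent? q q′ (y , y′) = product-residue (q′ , y′) ≟F product-residue (q , y)

    congruences : ℕ → ℕ → ℕ → ℕ
    congruences q q′ Y = ∑ (cartesianProduct (upTo Y) (upTo Y)) λ yy′ → ⟦ congruent? q q′ yy′ ⟧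

    -- Since q cancels modulo p, the two factors are congruent to each other, and an interval of
    -- length at most p contains only one member of a class. So the first factor determines the
    -- second.
    congruences-diagonal : ∀ q Y → Coprime p q → Y ≤ p → congruences q q Y ≤ Y
    congruences-diagonal q Y coprime Y≤p = ≤-trans
      (∑-pigeonhole _≟_ (congruent? q q) (cartesianProduct⁺ (upTo⁺ Y) (upTo⁺ Y)) (upTo Y) proj₁
        (λ yy′∈ _ → proj₁ (∈-cartesianProduct⁻ (upTo Y) (upTo Y) yy′∈)) inj)
      (≤-reflexive (length-upTo Y))
      where
      cancel : ∀ {y z} → y < Y → z < Y → (q * suc y) % p ≡ (q * suc z) % p → y ≡ z
      cancel {y} {z} y<Y z<Y eq with ≤-total y z
      ... | inj₁ y≤z = suc-injective (m%p-cancelˡ q coprime (s≤s y≤z)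
        (<-≤-trans (≤-<-trans (m∸n≤m z y) z<Y) Y≤p) eq)
      ... | inj₂ z≤y = sym (suc-injective (m%p-cancelˡ q coprime (s≤s z≤y)
        (<-≤-trans (≤-<-trans (m∸n≤m y z) y<Y) Y≤p) (sym eq)))
      inj : ∀ {yy′ zz′} → yy′ ∈ cartesianProduct (upTo Y) (upTo Y) → zz′ ∈ cartesianProduct (upTo Y) (upTo Y) →
        product-residue (q , proj₂ yy′) ≡ product-residue (q , proj₁ yy′) →
        product-residue (q , proj₂ zz′) ≡ product-residue (q , proj₁ zz′) →
        proj₁ yy′ ≡ proj₁ zz′ → yy′ ≡ zz′
      inj {y , y′} {.y , z′} yy′∈ zz′∈ eq eq′ refl = cong (y ,_)
        (cancel (∈-upTo⁻ (proj₂ (∈-cartesianProduct⁻ (upTo Y) (upTo Y) yy′∈)))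
                (∈-upTo⁻ (proj₂ (∈-cartesianProduct⁻ (upTo Y) (upTo Y) zz′∈)))
                (mod≡⇒%≡ (trans eq (sym eq′))))

    -- Cut the range of y′ into blocks of length q.  If q(y+1) ≡ q′(y′+1) mod p, then
    -- the residue of v = q(y+1) + q′(q - y′ % q) mod p depends only on the block of y′,
    -- and v determines y and y′ % q since q and q′ are coprime.
    congruences-off-diagonal : ∀ q q′ Y .{{_ : NonZero q}} → Coprime q q′ → q′ * q ≤ p →
      congruences q q′ Y ≤ suc (Y / q) * suc ((q * Y + p) / p)
    congruences-off-diagonal q q′ Y coprime q′q≤p = ≤-trans
      (∑-pigeonhole (≡-dec _≟_ _≟_) (congruent? q q′) (cartesianProduct⁺ (upTo⁺ Y) (upTo⁺ Y))
        (cartesianProduct (upTo (suc (Y / q))) (upTo (suc ((q * Y + p) / p)))) κ κ∈ κ-inj)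
      (≤-reflexive (trans (length-cartesianProduct (upTo (suc (Y / q))) (upTo (suc ((q * Y + p) / p))))
        (cong₂ _*_ (length-upTo (suc (Y / q))) (length-upTo (suc ((q * Y + p) / p))))))
      where
      v : ℕ × ℕ → ℕ
      -- The offset lies between 1 and q and stands for -(y′ % q) without negative numbers. It adds
      -- at most q′ q ≤ p to the value, whence the `+ p` in the range of the second key.
      v (y , y′) = q * suc y + q′ * (q ∸ y′ % q)
      κ : ℕ × ℕ → ℕ × ℕ
      κ yy′ = proj₂ yy′ / q , v yy′ / p

      κ∈ : ∀ {yy′} → yy′ ∈ cartesianProduct (upTo Y) (upTo Y) → _ →
           κ yy′ ∈ cartesianProduct (upTo (suc (Y / q))) (upTo (suc ((q * Y + p) / p)))
      κ∈ {y , y′} yy′∈ _ with ∈-cartesianProduct⁻ (upTo Y) (upTo Y) yy′∈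
      ... | y∈ , y′∈ = ∈-cartesianProduct⁺
        (∈-upTo⁺ (s≤s (/-monoˡ-≤ q (<⇒≤ (∈-upTo⁻ y′∈)))))
        (∈-upTo⁺ (s≤s (/-monoˡ-≤ p (+-mono-≤ (*-monoʳ-≤ q (∈-upTo⁻ y∈))
          (≤-trans (*-monoʳ-≤ q′ (m∸n≤m q (y′ % q))) q′q≤p)))))

      v%p : ∀ {y y′} → product-residue (q′ , y′) ≡ product-residue (q , y) →
            v (y , y′) % p ≡ (q′ * (suc q + y′ / q * q)) % p
      v%p {y} {y′} eq = begin
        (q * suc y + t) % p                        ≡⟨ %-distribˡ-+ (q * suc y) t p ⟩
        ((q * suc y) % p + t % p) % p              ≡⟨ cong (λ z → (z + t % p) % p) (mod≡⇒%≡ eq) ⟨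
        ((q′ * suc y′) % p + t % p) % p            ≡⟨ %-distribˡ-+ (q′ * suc y′) t p ⟨
        (q′ * suc y′ + t) % p                      ≡⟨ cong (_% p) (*-distribˡ-+ q′ (suc y′) _) ⟨
        (q′ * (suc y′ + (q ∸ y′ % q))) % p         ≡⟨ cong (λ z → (q′ * suc (z + (q ∸ y′ % q))) % p) (m≡m%n+[m/n]*n y′ q) ⟩
        (q′ * suc (r + y′ / q * q + (q ∸ r))) % p  ≡⟨ cong (λ z → (q′ * suc z) % p) (solve 3 (λ r b s → r :+ b :+ s := r :+ s :+ b) refl r (y′ / q * q) (q ∸ r)) ⟩
        (q′ * suc (r + (q ∸ r) + y′ / q * q)) % p  ≡⟨ cong (λ z → (q′ * suc (z + y′ / q * q)) % p) (m+[n∸m]≡n (m%n≤n y′ q)) ⟩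
        (q′ * (suc q + y′ / q * q)) % p            ∎
        where
        open ≡-Reasoning
        r = y′ % q
        t = q′ * (q ∸ y′ % q)

      offsets<q : ∀ y′ {r} → r < q → q ∸ y′ % q ∸ (q ∸ r) < q
      offsets<q y′ {r} r<q = ≤-<-trans (∸-monoˡ-≤ (q ∸ r) (m∸n≤m q (y′ % q)))
        (≤-<-trans (≤-reflexive (m∸[m∸n]≡n (<⇒≤ r<q))) r<q)

      v-inj : ∀ {y y′ z z′} → v (y , y′) ≡ v (z , z′) → y′ % q ≡ z′ % q × y ≡ z
      v-inj {y} {y′} {z} {z′} eq with ≤-total (q ∸ y′ % q) (q ∸ z′ % q)
      ... | inj₁ le = let t≡ , y≡ = linear-form-injective coprime le (offsets<q z′ (m%n<n y′ q)) eq
                      in ∸-cancelˡ-≡ (m%n≤n y′ q) (m%n≤n z′ q) t≡ , suc-injective y≡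
      ... | inj₂ le = let t≡ , y≡ = linear-form-injective coprime le (offsets<q y′ (m%n<n z′ q)) (sym eq)
                      in sym (∸-cancelˡ-≡ (m%n≤n z′ q) (m%n≤n y′ q) t≡) , sym (suc-injective y≡)

      κ-inj : ∀ {yy′ zz′} → yy′ ∈ cartesianProduct (upTo Y) (upTo Y) → zz′ ∈ cartesianProduct (upTo Y) (upTo Y) →
        product-residue (q′ , proj₂ yy′) ≡ product-residue (q , proj₁ yy′) →
        product-residue (q′ , proj₂ zz′) ≡ product-residue (q , proj₁ zz′) →
        κ yy′ ≡ κ zz′ → yy′ ≡ zz′
      κ-inj {y , y′} {z , z′} _ _ eq eq′ κ≡ with ,-injective κ≡
      ... | block≡ , v/p≡ with v-inj {y} {y′} {z} {z′} v≡
        where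
        open ≡-Reasoning
        v≡ : v (y , y′) ≡ v (z , z′)
        v≡ = begin
          v (y , y′)                                       ≡⟨ m≡m%n+[m/n]*n (v (y , y′)) p ⟩
          v (y , y′) % p + v (y , y′) / p * p              ≡⟨ cong₂ (λ a b → a + b * p) (v%p eq) v/p≡ ⟩
          (q′ * (suc q + y′ / q * q)) % p + v (z , z′) / p * p
            ≡⟨ cong (λ b → (q′ * (suc q + b * q)) % p + v (z , z′) / p * p) block≡ ⟩
          (q′ * (suc q + z′ / q * q)) % p + v (z , z′) / p * p
            ≡⟨ cong (_+ v (z , z′) / p * p) (v%p eq′) ⟨
          v (z , z′) % p + v (z , z′) / p * p              ≡⟨ m≡m%n+[m/n]*n (v (z , z′)) p ⟨
          v (z , z′)                                       ∎
      ...   | r≡ , y≡z = cong₂ _,_ y≡z (begin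
          y′                         ≡⟨ m≡m%n+[m/n]*n y′ q ⟩
          y′ % q + y′ / q * q        ≡⟨ cong₂ (λ a b → a + b * q) r≡ block≡ ⟩
          z′ % q + z′ / q * q        ≡⟨ m≡m%n+[m/n]*n z′ q ⟨
          z′                         ∎)
        where open ≡-Reasoning

    factor-pairs : List ℕ → ℕ → List (ℕ × ℕ)
    factor-pairs P Y = cartesianProduct P (upTo Y)

    length-factor-pairs : ∀ P Y → length (factor-pairs P Y) ≡ length P * Y
    length-factor-pairs P Y = trans (length-cartesianProduct P (upTo Y)) (cong (length P *_) (length-upTo Y))

    collisions≡∑congruences : ∀ P Y →
      collisions (factor-pairs P Y) product-residue ≡ ∑ P (λ q → ∑ P (λ q′ → congruences q q′ Y))
    collisions≡∑congruences P Y = begin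
      ∑ I (λ i → ∑ I (f i))
        ≡⟨ ∑-cong I (λ {i} _ → ∑-cartesianProduct P (upTo Y) (f i)) ⟩
      ∑ I (λ i → ∑ P (λ q′ → ∑ (upTo Y) (λ y′ → f i (q′ , y′))))
        ≡⟨ ∑-cartesianProduct P (upTo Y) _ ⟩
      ∑ P (λ q → ∑ (upTo Y) (λ y → ∑ P (λ q′ → ∑ (upTo Y) (λ y′ → f (q , y) (q′ , y′)))))
        ≡⟨ ∑-cong P (λ _ → ∑-swap (upTo Y) P _) ⟩
      ∑ P (λ q → ∑ P (λ q′ → ∑ (upTo Y) (λ y → ∑ (upTo Y) (λ y′ → f (q , y) (q′ , y′)))))
        ≡⟨ ∑-cong P (λ _ → ∑-cong P (λ _ → ∑-cartesianProduct (upTo Y) (upTo Y) _)) ⟨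
      ∑ P (λ q → ∑ P (λ q′ → congruences q q′ Y)) ∎
      where
      open ≡-Reasoning
      I = factor-pairs P Y
      f : ℕ × ℕ → ℕ × ℕ → ℕ
      f i j = ⟦ product-residue j ≟F product-residue i ⟧

    ∈image : ∀ P Y {r} → r ∈ˢ image (factor-pairs P Y) product-residue →
             ∃[ q ] ∃[ y ] (q ∈ P × y < Y × (q * suc y) mod p ≡ r)
    ∈image P Y {r} r∈
      with any? (λ i → product-residue i ≟F r) (factor-pairs P Y)
         | trans (sym (lookup∘tabulate (λ r → does (any? (λ i → product-residue i ≟F r) (factor-pairs P Y))) r)) ([]=⇒lookup r∈)
    ... | yes hit | _ with find hit
    ...   | (q , y) , qy∈ , eq with ∈-cartesianProduct⁻ P (upTo Y) qy∈
    ...     | q∈ , y∈ = q , y , q∈ , ∈-upTo⁻ y∈ , eq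
    ∈image P Y {r} r∈ | no _ | ()

  prime⇒coprime-distinct : ∀ {q q′} → Prime q → Prime q′ → q ≢ q′ → Coprime q q′
  prime⇒coprime-distinct {q} {q′} q-prime q′-prime q≢q′ with <-cmp q q′
  ... | tri< q<q′ _ _ = coprime-sym (prime⇒coprime q′-prime {{prime⇒nonZero q-prime}} q<q′)
  ... | tri≈ _ q≡q′ _ = contradiction q≡q′ q≢q′
  ... | tri> _ _ q′<q = prime⇒coprime q-prime {{prime⇒nonZero q′-prime}} q′<q

  -- Collisions and the size of the image for prime modulus.

  module _ {p : ℕ} .{{_ : NonZero p}} (p-prime : Prime p) where

    module _ (P : List ℕ) (Y x : ℕ)
      (P-unique : Unique P) (P-prime : ∀ {q} → q ∈ P → Prime q)
      (q≤x : ∀ {q} → q ∈ P → q ≤ x) (Q≤2q : ∀ {q} → q ∈ P → length P ≤ 2 * q)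
      (Q≤x : length P ≤ x) (x²≤p : x * x ≤ p) (x<p : x < p) (x≤Y : x ≤ Y) (Y≤p : Y ≤ p) where

      private
        Q = length P
        T = Q * Y

        bound : ℕ → ℕ
        -- A default value, since the next clause divides by `q`; the members of `P` are prime,
        -- hence nonzero.
        bound 0         = 0
        bound q@(suc _) = suc (Y / q) * suc ((q * Y + p) / p)

        congruences≤ : ∀ {q q′} → q ∈ P → q′ ∈ P → congruences {p} q q′ Y ≤ ⟦ q ≟ q′ ⟧ * Y + bound q
        congruences≤ {zero}  q∈ q′∈ = contradiction (P-prime q∈) ¬prime[0]
        congruences≤ {q@(suc _)} {q′} q∈ q′∈ with q ≟ q′
        ... | yes refl = ≤-trans (congruences-diagonal q Y (prime⇒coprime p-prime (≤-<-trans (q≤x q∈) x<p)) Y≤p)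
                           (≤-trans (≤-reflexive (trans (sym (*-identityˡ Y)) (cong (_* Y) (sym (⟦⟧-true (q ≟ q) refl))))) (m≤m+n _ (bound q)))
        ... | no q≢q′  = ≤-trans (congruences-off-diagonal q q′ Y
          (prime⇒coprime-distinct (P-prime q∈) (P-prime q′∈) q≢q′)
          (≤-trans (*-mono-≤ (q≤x q′∈) (q≤x q∈)) x²≤p)) (m≤n+m (bound q) _)

        -- The product (Y/q)(q Y) yields the main term. The rounding of the second factor costs 2p Q
        -- (Y/q + 1) ≤ 8pY, by Q ≤ 2q and q ≤ x ≤ Y; that of the first costs Q q Y ≤ x² Y ≤ pY.
        Qpbound≤ : ∀ {q} → q ∈ P → Q * (p * bound q) ≤ Q * (Y * Y) + 9 * (p * Y)
        Qpbound≤ {zero}  q∈ = contradiction (P-prime q∈) ¬prime[0]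
        Qpbound≤ {q@(suc _)} q∈ = begin
          Q * (p * (a * suc k))                           ≡⟨ solve 4 (λ Q p a k → Q :* (p :* (a :* (con 1 :+ k))) := Q :* (a :* (p :+ k :* p))) refl Q p a k ⟩
          Q * (a * (p + k * p))                           ≤⟨ *-monoʳ-≤ Q (*-monoʳ-≤ a (+-monoʳ-≤ p (m/n*n≤m (q * Y + p) p))) ⟩
          Q * (a * (p + (q * Y + p)))                     ≡⟨ solve 5 (λ Q p a q y → Q :* (a :* (p :+ (q :* y :+ p))) := Q :* (a :* q :* y) :+ con 2 :* (p :* (Q :* a))) refl Q p a q Y ⟩
          Q * (a * q * Y) + 2 * (p * (Q * a))             ≤⟨ +-mono-≤ (*-monoʳ-≤ Q (*-monoˡ-≤ Y aq≤)) (*-monoʳ-≤ 2 (*-monoʳ-≤ p Qa≤)) ⟩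
          Q * ((Y + q) * Y) + 2 * (p * (4 * Y))           ≡⟨ solve 4 (λ Q p q y → Q :* ((y :+ q) :* y) :+ con 2 :* (p :* (con 4 :* y)) := Q :* (y :* y) :+ (Q :* q :* y :+ con 8 :* (p :* y))) refl Q p q Y ⟩
          Q * (Y * Y) + (Q * q * Y + 8 * (p * Y))         ≤⟨ +-monoʳ-≤ (Q * (Y * Y)) (+-monoˡ-≤ (8 * (p * Y)) (*-monoˡ-≤ Y (≤-trans (*-mono-≤ Q≤x (q≤x q∈)) x²≤p))) ⟩
          Q * (Y * Y) + (p * Y + 8 * (p * Y))             ∎
          where
          open ≤-Reasoning
          a = suc (Y / q)
          k = (q * Y + p) / p
          aq≤ : a * q ≤ Y + q
          aq≤ = ≤-trans (≤-reflexive (+-comm q _)) (+-monoˡ-≤ q (m/n*n≤m Y q))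
          Qa≤ : Q * a ≤ 4 * Y
          Qa≤ = begin
            Q * a              ≤⟨ *-monoˡ-≤ a (Q≤2q q∈) ⟩
            2 * q * a          ≡⟨ trans (*-assoc 2 q a) (cong (2 *_) (*-comm q a)) ⟩
            2 * (a * q)        ≤⟨ *-monoʳ-≤ 2 aq≤ ⟩
            2 * (Y + q)        ≤⟨ *-monoʳ-≤ 2 (+-monoʳ-≤ Y (≤-trans (q≤x q∈) x≤Y)) ⟩
            2 * (Y + Y)        ≡⟨ solve 1 (λ y → con 2 :* (y :+ y) := con 4 :* y) refl Y ⟩
            4 * Y              ∎

      -- Nine of the ten copies of p T are the rounding errors of `Qpbound≤`; the tenth is p times
      -- the |P| diagonal terms Y.
      collisions≤ : p * collisions (factor-pairs {p} P Y) (product-residue {p}) ≤ T * T + 10 * (p * T)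
      collisions≤ = begin
        p * collisions (factor-pairs {p} P Y) (product-residue {p})
          ≡⟨ cong (p *_) (collisions≡∑congruences {p} P Y) ⟩
        p * ∑ P (λ q → ∑ P (λ q′ → congruences {p} q q′ Y))
          ≤⟨ *-monoʳ-≤ p (∑-mono P λ {q} q∈ → ∑-mono P λ {q′} q′∈ → congruences≤ {q} {q′} q∈ q′∈) ⟩
        p * ∑ P (λ q → ∑ P (λ q′ → ⟦ q ≟ q′ ⟧ * Y + bound q))
          ≡⟨ cong (p *_) (∑-cong P λ {q} q∈ → trans (∑-+ P _ _) (cong₂ _+_ (∑-sift _≟_ P-unique q∈ (λ _ → Y)) (∑-const P (bound q)))) ⟩
        p * ∑ P (λ q → Y + Q * bound q)
          ≡⟨ ∑-*ˡ P p _ ⟨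
        ∑ P (λ q → p * (Y + Q * bound q))
          ≤⟨ ∑-mono P (λ {q} q∈ → ≤-trans (≤-reflexive
               (solve 4 (λ p y Q b → p :* (y :+ Q :* b) := p :* y :+ Q :* (p :* b)) refl p Y Q (bound q)))
               (+-monoʳ-≤ (p * Y) (Qpbound≤ q∈))) ⟩
        ∑ P (λ q → p * Y + (Q * (Y * Y) + 9 * (p * Y)))
          ≡⟨ ∑-const P _ ⟩
        Q * (p * Y + (Q * (Y * Y) + 9 * (p * Y)))
          ≡⟨ solve 3 (λ Q p y → Q :* (p :* y :+ (Q :* (y :* y) :+ con 9 :* (p :* y))) := Q :* y :* (Q :* y) :+ con 10 :* (p :* (Q :* y))) refl Q p Y ⟩
        T * T + 10 * (p * T) ∎
        where
        open ≤-Reasoning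

      -- The mean term p T² in the collision bound, scaled by p, cancels one of the two copies of p
      -- T² in `second-moment`, up to the common factor of p; what survives is divisible by T.
      image-large : .{{_ : NonZero T}} →
        p * T ≤ 10 * (p * p) + T * size (image (factor-pairs {p} P Y) (product-residue {p}))
      image-large = *-cancelˡ-≤ T (+-cancelˡ-≤ (p * (T * T)) _ _ (begin
        p * (T * T) + T * (p * T)
          ≡⟨ solve 2 (λ p t → p :* (t :* t) :+ t :* (p :* t) := con 2 :* (p :* t) :* t) refl p T ⟩
        2 * (p * T) * T
          ≤⟨ subst (λ t → 2 * (p * t) * t ≤ p * p * E + t * t * H) (length-factor-pairs {p} P Y)
               (second-moment (factor-pairs {p} P Y) (product-residue {p})) ⟩
        p * p * E + T * T * H
          ≡⟨ cong (_+ T * T * H) (*-assoc p p E) ⟩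
        p * (p * E) + T * T * H
          ≤⟨ +-monoˡ-≤ (T * T * H) (*-monoʳ-≤ p collisions≤) ⟩
        p * (T * T + 10 * (p * T)) + T * T * H
          ≡⟨ solve 3 (λ p t h → p :* (t :* t :+ con 10 :* (p :* t)) :+ t :* t :* h := p :* (t :* t) :+ t :* (con 10 :* (p :* p) :+ t :* h)) refl p T H ⟩
        p * (T * T) + T * (10 * (p * p) + T * H) ∎))
        where
        open ≤-Reasoning
        E = collisions (factor-pairs {p} P Y) (product-residue {p})
        H = size (image (factor-pairs {p} P Y) (product-residue {p}))

    -- Multiplication by 2 is injective modulo an odd prime, so the p pairs (2, y) collide only with
    -- themselves; with E ≤ p and T = p the second moment leaves no class out.
    image-2-full : 2 < p → p ≤ size (image (factor-pairs {p} (2 ∷ []) p) (product-residue {p}))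
    image-2-full 2<p = *-cancelˡ-≤ (p * p) {{m*n≢0 p p}} (+-cancelˡ-≤ (p * p * p) _ _ (begin
      p * p * p + p * p * p
        ≡⟨ solve 1 (λ p → p :* p :* p :+ p :* p :* p := con 2 :* (p :* p) :* p) refl p ⟩
      2 * (p * p) * p
        ≤⟨ subst (λ t → 2 * (p * t) * t ≤ p * p * E + t * t * H) (trans (length-factor-pairs {p} (2 ∷ []) p) (*-identityˡ p))
             (second-moment (factor-pairs {p} (2 ∷ []) p) (product-residue {p})) ⟩
      p * p * E + p * p * H
        ≤⟨ +-monoˡ-≤ (p * p * H) (*-monoʳ-≤ (p * p) E≤p) ⟩
      p * p * p + p * p * H ∎))
      where
      open ≤-Reasoning
      E = collisions (factor-pairs {p} (2 ∷ []) p) (product-residue {p})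
      H = size (image (factor-pairs {p} (2 ∷ []) p) (product-residue {p}))
      E≤p : E ≤ p
      E≤p = ≤-trans (≤-reflexive (trans (collisions≡∑congruences {p} (2 ∷ []) p) (trans (+-identityʳ _) (+-identityʳ _))))
        (congruences-diagonal 2 p (prime⇒coprime p-prime 2<p) ≤-refl)

  -- Choice of the primes and the count of represented classes.

  length-filter-complement : {A : Set} {R : A → Set} (R? : Decidable R) (xs : List A) →
    length xs ≡ length (filter R? xs) + length (filter (λ x → ¬? (R? x)) xs)
  length-filter-complement R? []       = refl
  length-filter-complement R? (x ∷ xs) with R? x
  ... | yes _ = cong suc (length-filter-complement R? xs)
  ... | no  _ = trans (cong suc (length-filter-complement R? xs)) (sym (+-suc _ _))

  2^m≤2^n⇒m≤n : ∀ {m n} → 2 ^ m ≤ 2 ^ n → m ≤ n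
  2^m≤2^n⇒m≤n le = ≮⇒≥ λ n<m → <⇒≱ (^-monoʳ-< 2 (s≤s (s≤s z≤n)) n<m) le

  -- A prime q with 2q below the total number Q₀ of primes up to x is one of at most Q₀/2 positive
  -- integers, so at least half of the primes are kept. The constant is 16 = 4 * 2 * 2, from x ≤ 4n,
  -- j + 1 ≤ 2j and Q₀ ≤ 2 |P|, where n ≤ (j + 1) Q₀ is Chebyshev's bound in base 2.
  large-primes : ∀ x → 3 ≤ x → ∃[ P ] ( Unique P × (∀ {q} → q ∈ P → Prime q)
    × (∀ {q} → q ∈ P → q ≤ x) × (∀ {q} → q ∈ P → length P ≤ 2 * q)
    × length P ≤ x × x ≤ 16 * (floorLog 2 x * length P))
  large-primes x 3≤x = P , filter⁺ big? Ps-unique , proj₂ ∘ ∈Ps ∘ proj₁ ∘ ∈P , q≤x ∘ proj₁ ∘ ∈P ,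
    (λ q∈ → ≤-trans Q≤Q₀ (proj₂ (∈P q∈))) , Q≤x , x≤
    where
    Ps = primesUpTo x
    Q₀ = length Ps
    j = floorLog 2 x
    -- The largest n with 2n + 1 ≤ x.
    n = pred x / 2
    instance
      x≢0 : NonZero x
      x≢0 = >-nonZero (≤-trans (s≤s z≤n) 3≤x)
    Ps-unique : Unique Ps
    Ps-unique = filter⁺ prime? (upTo⁺ (suc x))
    ∈Ps : ∀ {q} → q ∈ Ps → q ∈ upTo (suc x) × Prime q
    ∈Ps q∈ = ∈-filter⁻ prime? {xs = upTo (suc x)} q∈
    q≤x : ∀ {q} → q ∈ Ps → q ≤ x
    q≤x q∈ = s≤s⁻¹ (∈-upTo⁻ (proj₁ (∈Ps q∈)))
    Big : ℕ → Set
    Big q = Q₀ ≤ 2 * q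
    big? : Decidable Big
    big? q = Q₀ ≤? 2 * q
    P = filter big? Ps
    ∈P : ∀ {q} → q ∈ P → q ∈ Ps × Big q
    ∈P q∈ = ∈-filter⁻ big? {xs = Ps} q∈
    small = length (filter (λ q → ¬? (big? q)) Ps)
    Q₀≡ : Q₀ ≡ length P + small
    Q₀≡ = length-filter-complement big? Ps
    Q≤Q₀ : length P ≤ Q₀
    Q≤Q₀ = ≤-trans (m≤m+n _ small) (≤-reflexive (sym Q₀≡))
    injective-pred : ∀ {q r} → q ∈ Ps → r ∈ Ps → pred q ≡ pred r → q ≡ r
    injective-pred q∈ r∈ = pred-injective {{prime⇒nonZero (proj₂ (∈Ps q∈))}} {{prime⇒nonZero (proj₂ (∈Ps r∈))}}
    Q≤x : length P ≤ x
    Q≤x = ≤-trans Q≤Q₀ (≤-trans (≤-trans (≤-reflexive (trans (sym (*-identityʳ Q₀)) (sym (∑-const Ps 1))))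
      (∑-pigeonhole _≟_ (λ q → 0 ≤? 0) Ps-unique (upTo x) pred
        (λ {q} q∈ _ → ∈-upTo⁺ (<-≤-trans (pred[n]<n {{prime⇒nonZero (proj₂ (∈Ps q∈))}}) (q≤x q∈)))
        (λ q∈ r∈ _ _ → injective-pred q∈ r∈))) (≤-reflexive (length-upTo x)))
      where
      pred[n]<n : ∀ {n} .{{_ : NonZero n}} → pred n < n
      pred[n]<n {suc n} = ≤-refl
    2small≤Q₀ : 2 * small ≤ Q₀
    2small≤Q₀ = ≤-trans (*-monoʳ-≤ 2 (≤-trans (≤-reflexive (length-filter≡∑ (λ q → ¬? (big? q)) Ps))
      (≤-trans (∑-pigeonhole _≟_ (λ q → ¬? (big? q)) Ps-unique (upTo (Q₀ / 2)) pred
        (λ {q} q∈ ¬big → ∈-upTo⁺ (pred<Q₀/2 {{prime⇒nonZero (proj₂ (∈Ps q∈))}} (<⇒≤ (≰⇒> ¬big))))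
        (λ q∈ r∈ _ _ → injective-pred q∈ r∈)) (≤-reflexive (length-upTo (Q₀ / 2))))))
      (≤-trans (≤-reflexive (*-comm 2 (Q₀ / 2))) (m/n*n≤m Q₀ 2))
      where
      pred<Q₀/2 : ∀ {q} .{{_ : NonZero q}} → 2 * q ≤ Q₀ → pred q < Q₀ / 2
      pred<Q₀/2 {suc q} 2q≤Q₀ = ≤-trans (≤-reflexive (sym (m*n/n≡m (suc q) 2)))
        (/-monoˡ-≤ 2 (≤-trans (≤-reflexive (*-comm (suc q) 2)) 2q≤Q₀))
    Q₀≤2Q : Q₀ ≤ 2 * length P
    Q₀≤2Q = +-cancelʳ-≤ Q₀ _ _ (begin
      Q₀ + Q₀                              ≡⟨ cong₂ _+_ Q₀≡ Q₀≡ ⟩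
      length P + small + (length P + small) ≡⟨ solve 2 (λ a b → a :+ b :+ (a :+ b) := con 2 :* a :+ con 2 :* b) refl (length P) small ⟩
      2 * length P + 2 * small             ≤⟨ +-monoʳ-≤ (2 * length P) 2small≤Q₀ ⟩
      2 * length P + Q₀                    ∎)
      where
      open ≤-Reasoning
    1≤j : 1 ≤ j
    1≤j = ≮⇒≥ λ j<1 → <⇒≱ (n<b^1+floorLog 2 x ≤-refl)
      (≤-trans (^-monoʳ-≤ 2 {suc j} {1} j<1) (≤-trans (n≤1+n 2) 3≤x))
    x≡ : x ≡ suc (pred x % 2 + n * 2)
    x≡ = trans (sym (suc-pred x)) (cong suc (m≡m%n+[m/n]*n (pred x) 2))
    n+n≡n*2 : n + n ≡ n * 2
    n+n≡n*2 = trans (cong (n +_) (sym (+-identityʳ n))) (*-comm 2 n)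
    1≤n : 1 ≤ n
    1≤n = m≥n⇒m/n>0 (pred-mono-≤ 3≤x)
    n≤ : n ≤ suc j * Q₀
    n≤ = 2^m≤2^n⇒m≤n (begin
      2 ^ n                  ≤⟨ chebyshev n x (≤-trans (s≤s (≤-trans (≤-reflexive n+n≡n*2) (m≤n+m _ (pred x % 2)))) (≤-reflexive (sym x≡))) ⟩
      x ^ Q₀                 ≤⟨ ^-monoˡ-≤ Q₀ (<⇒≤ (n<b^1+floorLog 2 x ≤-refl)) ⟩
      (2 ^ suc j) ^ Q₀       ≡⟨ ^-*-assoc 2 (suc j) Q₀ ⟩
      2 ^ (suc j * Q₀)       ∎)
      where open ≤-Reasoning
    x≤ : x ≤ 16 * (j * length P)
    x≤ = begin
      x                              ≡⟨ x≡ ⟩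
      suc (pred x % 2 + n * 2)       ≤⟨ s≤s (+-monoˡ-≤ (n * 2) (s≤s⁻¹ (m%n<n (pred x) 2))) ⟩
      2 + n * 2                      ≤⟨ +-monoˡ-≤ (n * 2) (*-monoˡ-≤ 2 1≤n) ⟩
      n * 2 + n * 2                  ≡⟨ solve 1 (λ n → n :* con 2 :+ n :* con 2 := con 4 :* n) refl n ⟩
      4 * n                          ≤⟨ *-monoʳ-≤ 4 n≤ ⟩
      4 * (suc j * Q₀)               ≤⟨ *-monoʳ-≤ 4 (*-mono-≤ (+-monoˡ-≤ j 1≤j) Q₀≤2Q) ⟩
      4 * ((j + j) * (2 * length P)) ≡⟨ solve 2 (λ j q → con 4 :* ((j :+ j) :* (con 2 :* q)) := con 16 :* (j :* q)) refl j (length P) ⟩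
      16 * (j * length P)            ∎
      where
      open ≤-Reasoning

  scale-bound : ∀ p d T m a b .{{_ : NonZero p}} →
    d * p ≤ a * T → T * m ≤ b * (p * p) → d * m ≤ a * b * p
  scale-bound p d T m a b dp≤aT Tm≤bp² = *-cancelˡ-≤ p (begin
    p * (d * m)            ≡⟨ solve 3 (λ p d m → p :* (d :* m) := d :* p :* m) refl p d m ⟩
    d * p * m              ≤⟨ *-monoˡ-≤ m dp≤aT ⟩
    a * T * m              ≡⟨ *-assoc a T m ⟩
    a * (T * m)            ≤⟨ *-monoʳ-≤ a Tm≤bp² ⟩
    a * (b * (p * p))      ≡⟨ solve 3 (λ a b p → a :* (b :* (p :* p)) := p :* (a :* b :* p)) refl a b p ⟩
    p * (a * b * p)        ∎)
    where open ≤-Reasoning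

  rearrange : ∀ a b d x j q → a * (d * x * (b * (j * q))) ≡ a * b * (q * (d * x * j))
  rearrange = solve 6 (λ a b d x j q → a :* (d :* x :* (b :* (j :* q))) := a :* b :* (q :* (d :* x :* j))) refl

  Represented : ∀ p .{{_ : NonZero p}} → ℕ → ℕ → Fin p → Set
  Represented p x Y r = ∃[ q ] ∃[ y ] (Prime q × q ≤ x × 1 ≤ y × y ≤ Y × (q * y) mod p ≡ r)

  all-represented : ∀ {p} .{{_ : NonZero p}} → Prime p → ∀ {x Y} → 2 < p → 2 ≤ x → p ≤ Y →
    ∃[ A ] ((∀ r → r ∈ˢ A → Represented p x Y r) × p ∸ size A ≡ 0)
  all-represented {p} p-prime {x} {Y} 2<p 2≤x p≤Y =
    image (factor-pairs {p} (2 ∷ []) p) (product-residue {p}) , witness , m≤n⇒m∸n≡0 (image-2-full p-prime 2<p)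
    where
    witness : ∀ r → r ∈ˢ image (factor-pairs {p} (2 ∷ []) p) (product-residue {p}) → Represented p x Y r
    witness r r∈ with ∈image (2 ∷ []) p r∈
    ... | q , y , here refl , y<p , eq = q , suc y , prime[2] , 2≤x , s≤s z≤n , ≤-trans y<p p≤Y , eq

  most-represented : ∀ {p} .{{_ : NonZero p}} → Prime p → ∀ x d → 3 ≤ x → 1 ≤ d →
    x * x ≤ p → p < suc x * suc x → d * x * floorLog 2 x ≤ p →
    ∃[ A ] ((∀ r → r ∈ˢ A → Represented p x (d * x * floorLog 2 x) r) × d * (p ∸ size A) ≤ 64 * 10 * p)
  most-represented {p} p-prime x d 3≤x 1≤d x²≤p p<[x+1]² Y≤p =
    let P , P-unique , P-prime , q≤x , Q≤2q , Q≤x , x≤16jQ = large-primes x 3≤x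
    in go P P-unique P-prime q≤x Q≤2q Q≤x x≤16jQ
    where
    j = floorLog 2 x
    Y = d * x * j
    go : (P : List ℕ) → Unique P → (∀ {q} → q ∈ P → Prime q) → (∀ {q} → q ∈ P → q ≤ x) →
      (∀ {q} → q ∈ P → length P ≤ 2 * q) → length P ≤ x → x ≤ 16 * (j * length P) →
      ∃[ A ] ((∀ r → r ∈ˢ A → Represented p x Y r) × d * (p ∸ size A) ≤ 64 * 10 * p)
    go P P-unique P-prime q≤x Q≤2q Q≤x x≤16jQ =
      image (factor-pairs {p} P Y) (product-residue {p}) , witness , scale-bound p d T m 64 10 dp≤64T Tm≤10p²
      where
      open ≤-Reasoning
      T = length P * Y
      H = size (image (factor-pairs {p} P Y) (product-residue {p}))
      m = p ∸ H
      0<x : 0 < x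
      0<x = ≤-trans (s≤s z≤n) 3≤x
      0<jQ : 0 < j * length P
      0<jQ = n≢0⇒n>0 λ jQ≡0 → <⇒≱ 0<x (≤-trans x≤16jQ (≤-reflexive (cong (16 *_) jQ≡0)))
      0<j : 0 < j
      0<j = n≢0⇒n>0 λ j≡0 → <⇒≢ 0<jQ (sym (cong (_* length P) j≡0))
      x≤Y : x ≤ Y
      x≤Y = ≤-trans (m≤n*m x d {{>-nonZero 1≤d}}) (m≤m*n (d * x) j {{>-nonZero 0<j}})
      -- The constant is 4 * 16: p < (x + 1)² ≤ 4x², and one factor x is then exchanged for 16 j
      -- |P|, which completes d x to T.
      dp≤64T : d * p ≤ 64 * T
      dp≤64T = begin
        d * p                                 ≤⟨ *-monoʳ-≤ d (<⇒≤ p<[x+1]²) ⟩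
        d * (suc x * suc x)                   ≤⟨ *-monoʳ-≤ d (*-mono-≤ (+-monoˡ-≤ x 0<x) (+-monoˡ-≤ x 0<x)) ⟩
        d * ((x + x) * (x + x))               ≡⟨ solve 2 (λ d x → d :* ((x :+ x) :* (x :+ x)) := con 4 :* (d :* x :* x)) refl d x ⟩
        4 * (d * x * x)                       ≤⟨ *-monoʳ-≤ 4 (*-monoʳ-≤ (d * x) x≤16jQ) ⟩
        4 * (d * x * (16 * (j * length P)))   ≡⟨ rearrange 4 16 d x j (length P) ⟩
        4 * 16 * T                            ≡⟨ cong (_* T) {4 * 16} {64} refl ⟩
        64 * T                                ∎
      x<p : x < p
      x<p = <-≤-trans (m<m*n x x {{>-nonZero 0<x}} (≤-trans (s≤s (s≤s z≤n)) 3≤x)) x²≤p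
      instance
        T≢0 : NonZero T
        T≢0 = m*n≢0 (length P) Y {{m*n≢0⇒n≢0 j {{>-nonZero 0<jQ}}}} {{>-nonZero (<-≤-trans 0<x x≤Y)}}
      Tm≤10p² : T * m ≤ 10 * (p * p)
      Tm≤10p² = begin
        T * (p ∸ H)                           ≡⟨ *-distribˡ-∸ T p H ⟩
        T * p ∸ T * H                         ≡⟨ cong (_∸ T * H) (*-comm T p) ⟩
        p * T ∸ T * H                         ≤⟨ ∸-monoˡ-≤ (T * H) (image-large p-prime P Y x P-unique P-prime q≤x Q≤2q Q≤x x²≤p x<p x≤Y Y≤p) ⟩
        10 * (p * p) + T * H ∸ T * H          ≡⟨ m+n∸n≡m (10 * (p * p)) (T * H) ⟩
        10 * (p * p)                          ∎
      witness : ∀ r → r ∈ˢ image (factor-pairs {p} P Y) (product-residue {p}) → Represented p x Y r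
      witness r r∈ with ∈image P Y r∈
      ... | q , y , q∈ , y<Y , eq = q , suc y , P-prime q∈ , q≤x q∈ , s≤s z≤n , y<Y , eq

  -- When Y reaches p, the diagonal count no longer applies, but then the single prime 2 already
  -- represents every class.
  product-residues-count : ∀ {p} .{{_ : NonZero p}} → Prime p → ∀ x d → 3 ≤ x → 1 ≤ d →
    x * x ≤ p → p < suc x * suc x →
    ∃[ A ] ((∀ r → r ∈ˢ A → Represented p x (d * x * floorLog 2 x) r) × d * (p ∸ size A) ≤ 64 * 10 * p)
  product-residues-count {p} p-prime x d 3≤x 1≤d x²≤p p<[x+1]² =
    [ (λ p≤Y → let A , A⊑ , missing≡0 = all-represented p-prime 2<p (≤-trans (n≤1+n 2) 3≤x) p≤Y
               in A , A⊑ , ≤-trans (≤-reflexive (trans (cong (d *_) missing≡0) (*-zeroʳ d))) z≤n)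
    , most-represented p-prime x d 3≤x 1≤d x²≤p p<[x+1]² ]′ (≤-total p (d * x * floorLog 2 x))
    where
    2<p : 2 < p
    2<p = ≤-trans 3≤x (≤-trans (m≤m*n x x {{>-nonZero (≤-trans (s≤s z≤n) 3≤x)}}) x²≤p)

open import Defs
open import Data.Nat.Base as ℕ using (ℕ)
open import Data.Nat.Primality using (Prime; prime⇒nonZero)
open import Data.Fin.Subset using (Subset) renaming (∣_∣ to size)
import Data.Nat.Properties as ℕ
open import Data.Product.Base using (Σ-syntax; ∃-syntax; _×_; _,_)

-- From natural bounds to Cauchy reals.

module RealEstimates where

  open Rationals
  open import Data.Integer.Base as ℤ using (ℤ; +_; -[1+_])
  import Data.Integer.Properties as ℤ
  open import Data.Nat.Base using (suc; zero; z≤n; s≤s)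
  open import Data.Fin.Subset.Properties using (∣p∣≤n; p⊆q⇒∣p∣≤∣q∣)
  open import Data.Nat.Solver using () renaming (module +-*-Solver to ℕ-Solver)
  open ℕ-Solver using (_:=_; _:+_; _:*_; con) renaming (solve to solveℕ)
  open import Data.Product.Base using (proj₁; proj₂)
  open import Data.Rational.Base as ℚ using (ℚ; mkℚ; 0ℚ; 1ℚ; toℚᵘ)
  import Data.Rational.Properties as ℚ
  open import Data.Rational.Solver using (module +-*-Solver)
  open +-*-Solver using () renaming (solve to solveℚ; _:=_ to _:≡_; _:+_ to _⊕_; _:-_ to _⊖_; _:*_ to _⊗_; :-_ to ⊝_)
  open import Data.Rational.Unnormalised.Base as ℚᵘ using (mkℚᵘ)
  import Data.Rational.Unnormalised.Properties as ℚᵘ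
  open import Function.Bundles using (Equivalence)
  open import Relation.Binary.PropositionalEquality
  open import Data.Sum.Base using ([_,_]′)
  open Chebyshev using (floorLog; b^floorLog≤n)
  open ProductResidueCount using (Represented; product-residues-count)
  open ℚ.≤-Reasoning

  frac-*-ℕ : ∀ a c b .{{_ : ℕ.NonZero b}} → frac a b ℚ.* frac c 1 ≡ frac (a ℕ.* c) b
  frac-*-ℕ a c (suc b) = ℚ.toℚᵘ-injective
    (ℚᵘ.≃-trans (ℚ.toℚᵘ-homo-* (frac a (suc b)) (frac c 1))
    (ℚᵘ.≃-trans (ℚᵘ.*-cong (toℚᵘ-frac a b) (toℚᵘ-frac c 0))
    (ℚᵘ.≃-trans (ℚᵘ.*≡* eq) (ℚᵘ.≃-sym {toℚᵘ (frac (a ℕ.* c) (suc b))} (toℚᵘ-frac (a ℕ.* c) b)))))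
    where
    eq : + a ℤ.* + c ℤ.* + suc b ≡ + (a ℕ.* c) ℤ.* (+ suc b ℤ.* + 1)
    eq = cong₂ ℤ._*_ (sym (ℤ.pos-* a c)) (sym (ℤ.*-identityʳ (+ suc b)))

  ≤-natural : ∀ s → ∃[ n ] s ℚ.≤ frac n 1
  ≤-natural (mkℚ (+ n) d c) = n , ℚ.toℚᵘ-cancel-≤
    (ℚᵘ.≤-respʳ-≃ (ℚᵘ.≃-sym {toℚᵘ (frac n 1)} (toℚᵘ-frac n 0))
      (ℚᵘ.*≤* (ℤ.*-monoˡ-≤-nonNeg (+ n) {+ 1} {+ suc d} (ℤ.+≤+ (s≤s z≤n)))))
  ≤-natural s@(mkℚ -[1+ _ ] _ _) = 0 , ℚ.<⇒≤ (ℚ.negative⁻¹ s)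

  floor-from : ∀ s c b → frac b 1 ℚ.≤ s → s ℚ.≤ frac (c ℕ.+ b) 1 →
    ∃[ e ] (b ℕ.≤ e × frac e 1 ℚ.≤ s × s ℚ.≤ frac (suc e) 1)
  floor-from s zero    b b≤s s≤b = b , ℕ.≤-refl , b≤s ,
    ℚ.≤-trans s≤b (frac-≤ {b} {1} {suc b} {1} (ℕ.*-monoˡ-≤ 1 (ℕ.n≤1+n b)))
  floor-from s (suc c) b b≤s s≤ =
    [ (λ s≤1+b → b , ℕ.≤-refl , b≤s , s≤1+b)
    , (λ 1+b≤s → let e , b<e , e≤s , s≤1+e = floor-from s c (suc b) 1+b≤s
                                               (subst (λ n → s ℚ.≤ frac n 1) (sym (ℕ.+-suc c b)) s≤)
                 in e , ℕ.≤-trans (ℕ.n≤1+n b) b<e , e≤s , s≤1+e)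
    ]′ (ℚ.≤-total s (frac (suc b) 1))

  floor-≥ : ∀ s b → frac b 1 ℚ.≤ s → ∃[ e ] (b ℕ.≤ e × frac e 1 ℚ.≤ s × s ℚ.≤ frac (suc e) 1)
  floor-≥ s b b≤s = let n , s≤n = ≤-natural s in
    floor-from s n b b≤s (ℚ.≤-trans s≤n (frac-≤ {n} {1} {n ℕ.+ b} {1} (ℕ.*-monoˡ-≤ 1 (ℕ.m≤m+n n b))))

  +-cancelʳ-≤ : ∀ {x y} z → x ℚ.+ z ℚ.≤ y ℚ.+ z → x ℚ.≤ y
  +-cancelʳ-≤ {x} {y} z x+z≤y+z = begin
    x                    ≡⟨ solveℚ 2 (λ x z → x :≡ x ⊕ z ⊖ z) refl x z ⟩
    x ℚ.+ z ℚ.- z        ≤⟨ ℚ.+-monoˡ-≤ (ℚ.- z) x+z≤y+z ⟩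
    y ℚ.+ z ℚ.- z        ≡⟨ solveℚ 2 (λ y z → y ⊕ z ⊖ z :≡ y) refl y z ⟩
    y ∎

  ∣-∣≤⇒≤+ : ∀ {x y z} → ℚ.∣ x ℚ.- y ∣ ℚ.≤ z → x ℚ.≤ y ℚ.+ z
  ∣-∣≤⇒≤+ {x} {y} {z} ∣x-y∣≤z = begin
    x                    ≡⟨ solveℚ 2 (λ x y → x :≡ y ⊕ (x ⊖ y)) refl x y ⟩
    y ℚ.+ (x ℚ.- y)      ≤⟨ ℚ.+-monoʳ-≤ y (ℚ.≤-trans (x≤∣x∣ (x ℚ.- y)) ∣x-y∣≤z) ⟩
    y ℚ.+ z ∎

  frac-suc : ∀ n → frac (suc n) 1 ≡ frac n 1 ℚ.+ 1ℚ
  frac-suc n = trans (cong (λ k → frac k 1) (ℕ.+-comm 1 n)) (frac-+ n 1 1)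

  fromℕ-mono : ∀ {m n} → m ℕ.≤ n → frac m 1 ℚ.≤ frac n 1
  fromℕ-mono {m} {n} m≤n = frac-≤ {m} {1} {n} {1} (ℕ.*-monoˡ-≤ 1 m≤n)

  -- With slack 1 in `4 ≤ x`, a late term is at least 3, and so is its floor e. Later terms differ
  -- from it by at most 1, so d = e - 1 stays below them, while they stay below e + 2 = d + 3 ≤ 4d,
  -- as d ≥ 2.
  natural-approximation : ∀ x → fromℕ 4 ≤ x → ∃[ d ] (1 ℕ.≤ d ×
    ∃[ N ] (∀ n → N ℕ.≤ n → frac d 1 ℚ.≤ seq x n × seq x n ℚ.≤ frac (4 ℕ.* d) 1))
  natural-approximation x 4≤x =
    let N₁ , close = cauchy x 1ℚ (ℚ.positive⁻¹ 1ℚ)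
        N₂ , large = 4≤x 1ℚ (ℚ.positive⁻¹ 1ℚ)
        N  = N₁ ℕ.⊔ N₂
        4≤s+1 = large N (ℕ.m≤n⊔m N₁ N₂)
        e , 3≤e , e≤s , s≤1+e = floor-≥ (seq x N) 3 (+-cancelʳ-≤ 1ℚ (subst (ℚ._≤ seq x N ℚ.+ 1ℚ) (frac-suc 3) 4≤s+1))
    in ℕ.pred e , ℕ.≤-trans (s≤s z≤n) (ℕ.pred-mono-≤ 3≤e) , N , λ n N≤n →
       bounds e 3≤e e≤s s≤1+e
         (∣-∣≤⇒≤+ {seq x N} (close N n (ℕ.m≤m⊔n N₁ N₂) (ℕ.≤-trans (ℕ.m≤m⊔n N₁ N₂) N≤n)))
         (∣-∣≤⇒≤+ {seq x n} (close n N (ℕ.≤-trans (ℕ.m≤m⊔n N₁ N₂) N≤n) (ℕ.m≤m⊔n N₁ N₂)))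
    where
    bounds : ∀ {s t} e → 3 ℕ.≤ e → frac e 1 ℚ.≤ s → s ℚ.≤ frac (suc e) 1 → s ℚ.≤ t ℚ.+ 1ℚ → t ℚ.≤ s ℚ.+ 1ℚ →
             frac (ℕ.pred e) 1 ℚ.≤ t × t ℚ.≤ frac (4 ℕ.* ℕ.pred e) 1
    bounds {s} {t} (suc d) (s≤s 2≤d) e≤s s≤1+e s≤t+1 t≤s+1 =
      +-cancelʳ-≤ 1ℚ (begin
        frac d 1 ℚ.+ 1ℚ            ≡⟨ frac-suc d ⟨
        frac (suc d) 1             ≤⟨ e≤s ⟩
        s                          ≤⟨ s≤t+1 ⟩
        t ℚ.+ 1ℚ                   ∎) ,
      (begin
        t                          ≤⟨ t≤s+1 ⟩
        s ℚ.+ 1ℚ                   ≤⟨ ℚ.+-monoˡ-≤ 1ℚ s≤1+e ⟩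
        frac (2 ℕ.+ d) 1 ℚ.+ 1ℚ    ≡⟨ frac-suc (2 ℕ.+ d) ⟨
        frac (3 ℕ.+ d) 1           ≤⟨ fromℕ-mono 3+d≤4d ⟩
        frac (4 ℕ.* d) 1           ∎)
      where
      3+d≤4d : 3 ℕ.+ d ℕ.≤ 4 ℕ.* d
      3+d≤4d = ℕ.≤-trans (ℕ.≤-reflexive (ℕ.+-comm 3 d)) (ℕ.+-monoʳ-≤ d
        (ℕ.≤-trans (ℕ.n≤1+n 3) (ℕ.≤-trans (ℕ.+-mono-≤ 2≤d 2≤d) (ℕ.+-monoʳ-≤ d (ℕ.m≤m+n d _)))))

  ≤-isqrt : ∀ {r n} → r ℕ.* r ℕ.≤ n → r ℕ.≤ isqrt n
  ≤-isqrt {r} {n} r²≤n = ℕ.≮⇒≥ λ lt → ℕ.<⇒≱ (isqrt-upper n) (ℕ.≤-trans (ℕ.*-mono-≤ lt lt) r²≤n)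

  isqrt≤sqrtSeq : ∀ n k → frac (isqrt n) 1 ℚ.≤ sqrtSeq n k
  isqrt≤sqrtSeq n k = frac-≤ {isqrt n} {1} {isqrt (n ℕ.* (suc k ℕ.* suc k))} {suc k}
    (subst (isqrt n ℕ.* suc k ℕ.≤_) (sym (ℕ.*-identityʳ _)) (≤-isqrt (subst (ℕ._≤ n ℕ.* (suc k ℕ.* suc k))
      (solveℕ 2 (λ a b → a :* a :* (b :* b) := a :* b :* (a :* b)) refl (isqrt n) (suc k))
      (ℕ.*-monoˡ-≤ (suc k ℕ.* suc k) (isqrt-lower n)))))

  -- A lower bound for the Riemann sums of the logarithm.

  module _ (k : ℕ) where

    private
      f : ℕ → ℚ
      f i = frac 1 (suc k ℕ.+ suc i)

    -- This is `logSeq (suc N) k`, the Riemann sum of 1/t over [1, N + 1].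
    harmonic : ℕ → ℚ
    harmonic N = ∑ (N ℕ.* suc k) f

    ∑-nonNeg : ∀ n {g : ℕ → ℚ} → (∀ i → 0ℚ ℚ.≤ g i) → 0ℚ ℚ.≤ ∑ n g
    ∑-nonNeg zero    0≤g = ℚ.≤-refl
    ∑-nonNeg (suc n) 0≤g = ℚ.+-mono-≤ (∑-nonNeg n 0≤g) (0≤g n)

    harmonic-+ : ∀ a b → harmonic (a ℕ.+ b) ≡ harmonic a ℚ.+ ∑ (b ℕ.* suc k) (λ j → f (a ℕ.* suc k ℕ.+ j))
    harmonic-+ a b = trans (cong (λ n → ∑ n f) (ℕ.*-distribʳ-+ (suc k) a b)) (∑-++ (a ℕ.* suc k) (b ℕ.* suc k) f)

    harmonic-mono : ∀ {M N} → M ℕ.≤ N → harmonic M ℚ.≤ harmonic N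
    harmonic-mono {M} {N} M≤N = begin
      harmonic M                     ≡⟨ ℚ.+-identityʳ _ ⟨
      harmonic M ℚ.+ 0ℚ              ≤⟨ ℚ.+-monoʳ-≤ (harmonic M) (∑-nonNeg ((N ℕ.∸ M) ℕ.* suc k) (λ j → frac-nonNeg 1 (suc k ℕ.+ suc (M ℕ.* suc k ℕ.+ j)))) ⟩
      harmonic M ℚ.+ ∑ ((N ℕ.∸ M) ℕ.* suc k) (λ j → f (M ℕ.* suc k ℕ.+ j))
                                     ≡⟨ harmonic-+ M (N ℕ.∸ M) ⟨
      harmonic (M ℕ.+ (N ℕ.∸ M))     ≡⟨ cong harmonic (ℕ.m+[n∸m]≡n M≤N) ⟩
      harmonic N                     ∎

    -- The added terms belong to the interval [a + 1, 2a + 2]: there are (a + 1)(k + 1) of them,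
    -- each at least half the reciprocal of that number.
    harmonic-double : ∀ a → harmonic a ℚ.+ frac 1 2 ℚ.≤ harmonic (a ℕ.+ suc a)
    harmonic-double a = begin
      harmonic a ℚ.+ frac 1 2
        ≤⟨ ℚ.+-monoʳ-≤ (harmonic a) (frac-≤ {1} {2} {n} {n ℕ.* 2} (ℕ.≤-reflexive (ℕ.*-identityˡ (n ℕ.* 2)))) ⟩
      harmonic a ℚ.+ frac n (n ℕ.* 2)
        ≡⟨ cong (harmonic a ℚ.+_) (∑-const n (n ℕ.* 2)) ⟨
      harmonic a ℚ.+ ∑ n (λ _ → frac 1 (n ℕ.* 2))
        ≤⟨ ℚ.+-monoʳ-≤ (harmonic a) (∑-mono n λ j j<n →
             frac1-antimono {suc k ℕ.+ suc (a ℕ.* suc k ℕ.+ j)} {n ℕ.* 2} (denominator≤ j j<n)) ⟩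
      harmonic a ℚ.+ ∑ n (λ j → f (a ℕ.* suc k ℕ.+ j))
        ≡⟨ harmonic-+ a (suc a) ⟨
      harmonic (a ℕ.+ suc a) ∎
      where
      n = suc a ℕ.* suc k
      denominator≤ : ∀ j → j ℕ.< n → suc k ℕ.+ suc (a ℕ.* suc k ℕ.+ j) ℕ.≤ n ℕ.* 2
      denominator≤ j j<n = subst₂ ℕ._≤_
        (solveℕ 3 (λ m b j → m :+ b :+ (con 1 :+ j) := m :+ (con 1 :+ (b :+ j))) refl (suc k) (a ℕ.* suc k) j)
        (solveℕ 1 (λ n → n :+ n := n :* con 2) refl n)
        (ℕ.+-monoʳ-≤ n j<n)

    half-binary-log≤harmonic : ∀ i N → 2 ℕ.^ i ℕ.≤ suc N → frac i 2 ℚ.≤ harmonic N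
    half-binary-log≤harmonic zero    N _ = ∑-nonNeg (N ℕ.* suc k) λ i → frac-nonNeg 1 (suc k ℕ.+ suc i)
    half-binary-log≤harmonic (suc i) N 2^[1+i]≤1+N = begin
      frac (suc i) 2                  ≡⟨ cong (λ n → frac n 2) (ℕ.+-comm 1 i) ⟩
      frac (i ℕ.+ 1) 2                ≡⟨ frac-+ i 1 2 ⟩
      frac i 2 ℚ.+ frac 1 2           ≤⟨ ℚ.+-monoˡ-≤ (frac 1 2) (half-binary-log≤harmonic i a (ℕ.≤-reflexive (sym 1+a≡))) ⟩
      harmonic a ℚ.+ frac 1 2         ≤⟨ harmonic-double a ⟩
      harmonic (a ℕ.+ suc a)          ≤⟨ harmonic-mono (ℕ.s≤s⁻¹ (subst (ℕ._≤ suc N) 2^[1+i]≡ 2^[1+i]≤1+N)) ⟩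
      harmonic N                      ∎
      where
      a = ℕ.pred (2 ℕ.^ i)
      1+a≡ : suc a ≡ 2 ℕ.^ i
      1+a≡ = ℕ.suc-pred (2 ℕ.^ i) {{ℕ.m^n≢0 2 i}}
      2^[1+i]≡ : 2 ℕ.^ suc i ≡ suc a ℕ.+ suc a
      2^[1+i]≡ = trans (cong (2 ℕ.*_) (sym 1+a≡)) (cong (suc a ℕ.+_) (ℕ.+-identityʳ (suc a)))

  -- As 2^(2j) ≤ x² ≤ n, the argument doubles 2j times, each time gaining 1/2. Squaring x thus makes
  -- up for the crude estimate 1/2 for log 2.
  ≤-logSeq : ∀ {x n} k .{{_ : ℕ.NonZero x}} → x ℕ.* x ℕ.≤ n → frac (floorLog 2 x) 1 ℚ.≤ logSeq n k
  ≤-logSeq {x} {n} k x²≤n = ℚ.≤-trans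
    (frac-≤ {j} {1} {j ℕ.+ j} {2} (ℕ.≤-reflexive (solveℕ 1 (λ j → j :* con 2 := (j :+ j) :* con 1) refl j)))
    (half-binary-log≤harmonic k (j ℕ.+ j) (n ℕ.∸ 1) (ℕ.≤-trans
      (ℕ.≤-reflexive (ℕ.^-distribˡ-+-* 2 j j))
      (ℕ.≤-trans (ℕ.*-mono-≤ (b^floorLog≤n 2 x) (b^floorLog≤n 2 x)) (ℕ.≤-trans x²≤n (ℕ.m≤n+m∸n n 1)))))
    where
    j = floorLog 2 x

  -- Assembly of the asymptotic statement.

  product-≥ : ∀ {a b c x y z} → frac a 1 ℚ.≤ x → frac b 1 ℚ.≤ y → frac c 1 ℚ.≤ z →
              frac (a ℕ.* b ℕ.* c) 1 ℚ.≤ x ℚ.* y ℚ.* z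
  product-≥ {a} {b} {c} {x} {y} {z} a≤x b≤y c≤z = begin
    frac (a ℕ.* b ℕ.* c) 1                   ≡⟨ frac-*-ℕ (a ℕ.* b) c 1 ⟨
    frac (a ℕ.* b) 1 ℚ.* frac c 1            ≡⟨ cong (ℚ._* frac c 1) (frac-*-ℕ a b 1) ⟨
    frac a 1 ℚ.* frac b 1 ℚ.* frac c 1       ≤⟨ *-mono-≤ {frac a 1 ℚ.* frac b 1} {x ℚ.* y} {frac c 1} {z}
                                                  (0≤* (frac-nonNeg a 1) (frac-nonNeg b 1))
                                                  (*-mono-≤ {frac a 1} {x} {frac b 1} {y} (frac-nonNeg a 1) a≤x (frac-nonNeg b 1) b≤y)
                                                  (frac-nonNeg c 1) c≤z ⟩
    x ℚ.* y ℚ.* z ∎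

  eventually-≤ : ∀ {x y} N → (∀ n → N ℕ.≤ n → seq x n ℚ.≤ seq y n) → x ≤ y
  eventually-≤ {x} {y} N x≤y ε 0<ε = N , λ n N≤n → begin
    seq x n            ≤⟨ x≤y n N≤n ⟩
    seq y n            ≡⟨ ℚ.+-identityʳ (seq y n) ⟨
    seq y n ℚ.+ 0ℚ     ≤⟨ ℚ.+-monoʳ-≤ (seq y n) (ℚ.<⇒≤ 0<ε) ⟩
    seq y n ℚ.+ ε      ∎

  -- The error is exactly ε = -(p - n)/p, and 4K arises from ((p - n)/p) x ≤ 4d (p - n)/p ≤ 4K. The
  -- reciprocal cuts its terms off from below at the witness of `0ℝ < x`; fixing that witness to be
  -- 1 keeps the cut-off terms `1ℚ ⊔ seq x k` below 4d.
  asymptotic : ∀ {p n d K N} .{{_ : ℕ.NonZero p}} (x : ℝ) (1≤d : 1 ℕ.≤ d) →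
    (bounds : ∀ k → N ℕ.≤ k → frac d 1 ℚ.≤ seq x k × seq x k ℚ.≤ frac (4 ℕ.* d) 1) →
    (x>0 : 0ℝ < x) → proj₁ x>0 ≡ 1ℚ →
    n ℕ.≤ p → d ℕ.* (p ℕ.∸ n) ℕ.≤ K ℕ.* p →
    n ≃[1+O fromℕ (4 ℕ.* K) ∙ x ⁻¹⟨ x>0 ⟩ ] p
  asymptotic {p} {n} {d} {K} {N} x 1≤d bounds x>0@(.1ℚ , 0<1 , _) refl n≤p dm≤Kp =
    fromℚ (ℚ.- q) , eventually-≤ {∣ fromℚ (ℚ.- q) ∣} {fromℕ C * x ⁻¹⟨ x>0 ⟩} N small ,
    eventually-≤ {fromℕ n} {R} 0 (λ _ _ → ℚ.≤-reflexive exact) ,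
    eventually-≤ {R} {fromℕ n} 0 (λ _ _ → ℚ.≤-reflexive (sym exact))
    where
    m = p ℕ.∸ n
    q = frac m p
    C = 4 ℕ.* K
    R = (1ℝ + fromℚ (ℚ.- q)) * fromℕ p
    exact : frac n 1 ≡ (1ℚ ℚ.+ ℚ.- q) ℚ.* frac p 1
    exact = begin-equality
      frac n 1                              ≡⟨ solveℚ 2 (λ n m → n :≡ n ⊕ m ⊖ m) refl (frac n 1) (frac m 1) ⟩
      frac n 1 ℚ.+ frac m 1 ℚ.- frac m 1    ≡⟨ cong₂ ℚ._-_ (trans (sym (frac-+ n m 1)) (cong (λ k → frac k 1) (ℕ.m+[n∸m]≡n n≤p))) (sym qp≡m) ⟩
      frac p 1 ℚ.- q ℚ.* frac p 1           ≡⟨ cong (ℚ._- q ℚ.* frac p 1) (ℚ.*-identityˡ (frac p 1)) ⟨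
      1ℚ ℚ.* frac p 1 ℚ.- q ℚ.* frac p 1    ≡⟨ solveℚ 3 (λ o q p → o ⊗ p ⊖ q ⊗ p :≡ (o ⊕ ⊝ q) ⊗ p) refl 1ℚ q (frac p 1) ⟩
      (1ℚ ℚ.+ ℚ.- q) ℚ.* frac p 1           ∎
      where
      qp≡m : q ℚ.* frac p 1 ≡ frac m 1
      qp≡m = trans (frac-*-ℕ m p p) (ℚ.≤-antisym
        (frac-≤ {m ℕ.* p} {p} {m} {1} (ℕ.≤-reflexive (ℕ.*-identityʳ (m ℕ.* p))))
        (frac-≤ {m} {1} {m ℕ.* p} {p} (ℕ.≤-reflexive (sym (ℕ.*-identityʳ (m ℕ.* p))))))
    small : ∀ k → N ℕ.≤ k → ℚ.∣ ℚ.- q ∣ ℚ.≤ frac C 1 ℚ.* CauchySequences.1/⊔ 0<1 (seq x k)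
    small k N≤k = begin
      ℚ.∣ ℚ.- q ∣                      ≡⟨ ℚ.∣-p∣≡∣p∣ q ⟩
      ℚ.∣ q ∣                          ≡⟨ ℚ.0≤p⇒∣p∣≡p (frac-nonNeg m p) ⟩
      q                                ≡⟨ ℚ.*-identityʳ q ⟨
      q ℚ.* 1ℚ                         ≡⟨ cong (q ℚ.*_) (ℚ.*-inverseʳ a {{ℚ.>-nonZero 0<a}}) ⟨
      q ℚ.* (a ℚ.* u)                  ≡⟨ ℚ.*-assoc q a u ⟨
      q ℚ.* a ℚ.* u                    ≤⟨ ℚ.*-monoʳ-≤-nonNeg u {{ℚ.nonNegative (ℚ.<⇒≤ (1/-pos 0<a))}} qa≤C ⟩
      frac C 1 ℚ.* u                   ∎
      where
      a = 1ℚ ℚ.⊔ seq x k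
      0<a : 0ℚ ℚ.< a
      0<a = CauchySequences.0<⊔ (seq x k) 0<1
      u = CauchySequences.1/⊔ 0<1 (seq x k)
      a≤4d : a ℚ.≤ frac (4 ℕ.* d) 1
      a≤4d = ℚ.⊔-lub (fromℕ-mono {1} {4 ℕ.* d} (ℕ.≤-trans 1≤d (ℕ.m≤m+n d _))) (proj₂ (bounds k N≤k))
      qa≤C : q ℚ.* a ℚ.≤ frac C 1
      qa≤C = begin
        q ℚ.* a                        ≤⟨ ℚ.*-monoˡ-≤-nonNeg q {{ℚ.nonNegative (frac-nonNeg m p)}} a≤4d ⟩
        q ℚ.* frac (4 ℕ.* d) 1         ≡⟨ frac-*-ℕ m (4 ℕ.* d) p ⟩
        frac (m ℕ.* (4 ℕ.* d)) p       ≤⟨ frac-≤ {m ℕ.* (4 ℕ.* d)} {p} {C} {1} (subst₂ ℕ._≤_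
                                            (solveℕ 2 (λ d m → con 4 :* (d :* m) := m :* (con 4 :* d) :* con 1) refl d m)
                                            (sym (ℕ.*-assoc 4 K p))
                                            (ℕ.*-monoʳ-≤ 4 dm≤Kp)) ⟩
        frac C 1                       ∎

  -- A subset B of exact size contains the constructed A, so it misses no more classes than A does.
  -- The bound 9 makes `isqrt p` at least 3, as the supply of primes requires, and 640 = 64 * 10
  -- combines the lower bound for T with the collision error.
  residues-at-prime : ∀ p (p-prime : Prime p) .{{_ : ℕ.NonZero p}} → 9 ℕ.≤ p → (x : ℝ) → fromℕ 4 ≤ x →
    Σ[ x>0 ∈ 0ℝ < x ] (∃[ A ] (A ⊑ ProductResidues p (√ p) (x * √ p * log p) × size A ≃[1+O fromℕ (4 ℕ.* 640) ∙ x ⁻¹⟨ x>0 ⟩ ] p))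
      × (∀ A → A ≐ ProductResidues p (√ p) (x * √ p * log p) → size A ≃[1+O fromℕ (4 ℕ.* 640) ∙ x ⁻¹⟨ x>0 ⟩ ] p)
  residues-at-prime p p-prime 9≤p x 4≤x =
    let d , 1≤d , N , bounds = natural-approximation x 4≤x
        A , A⊑ , missing≤ = product-residues-count p-prime (isqrt p) d 3≤r 1≤d (isqrt-lower p) (isqrt-upper p)
        x>0 : 0ℝ < x
        x>0 = 1ℚ , ℚ.positive⁻¹ 1ℚ , N , λ n N≤n → ℚ.≤-trans (fromℕ-mono {1} {d} 1≤d) (proj₁ (bounds n N≤n))
        S = ProductResidues p (√ p) (x * √ p * log p)
        A⊑S : A ⊑ S
        A⊑S = λ r r∈ → in-S d N (λ n N≤n → proj₁ (bounds n N≤n)) (A⊑ r r∈)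
    in x>0 , (A , A⊑S , asymptotic {K = 640} x 1≤d bounds x>0 refl (∣p∣≤n A) missing≤)
     , λ B B≐S → asymptotic {K = 640} x 1≤d bounds x>0 refl (∣p∣≤n B)
         (ℕ.≤-trans (ℕ.*-monoʳ-≤ d (ℕ.∸-monoʳ-≤ p (p⊆q⇒∣p∣≤∣q∣ λ {r} r∈ → Equivalence.from (B≐S r) (A⊑S r r∈)))) missing≤)
    where
    3≤r : 3 ℕ.≤ isqrt p
    3≤r = ≤-isqrt 9≤p
    in-S : ∀ d N {r} → (∀ n → N ℕ.≤ n → frac d 1 ℚ.≤ seq x n) →
      Represented p (isqrt p) (d ℕ.* isqrt p ℕ.* floorLog 2 (isqrt p)) r → ProductResidues p (√ p) (x * √ p * log p) r
    in-S d N d≤x (q , y , q-prime , q≤r , 1≤y , y≤ , eq) = q , y ,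
      (ℕ.>-nonZero⁻¹ q {{prime⇒nonZero q-prime}} ,
       eventually-≤ {fromℕ q} {√ p} 0 (λ k _ → ℚ.≤-trans (fromℕ-mono q≤r) (isqrt≤sqrtSeq p k)) , q-prime) ,
      (1≤y , eventually-≤ {fromℕ y} {x * √ p * log p} N (λ k N≤k → ℚ.≤-trans (fromℕ-mono y≤)
        (product-≥ {d} {isqrt p} {floorLog 2 (isqrt p)} (d≤x k N≤k) (isqrt≤sqrtSeq p k)
          (≤-logSeq k {{ℕ.>-nonZero (ℕ.≤-trans (s≤s z≤n) 3≤r)}} (isqrt-lower p))))) , eq

corollary7 : (Δ : ℕ → ℝ) → TendsToInfinity Δ →
    ∃[ C ] ∃[ P ] ∀ (p : ℕ) (p-prime : Prime p) → P ℕ.≤ p →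
    Σ[ Δ>0 ∈ 0ℝ < Δ p ]
    let S = ProductResidues p {{prime⇒nonZero p-prime}} (√ p) (Δ p * √ p * log p)
    in (∃[ A ] (A ⊑ S × size A ≃[1+O C ∙ Δ p ⁻¹⟨ Δ>0 ⟩ ] p))
    × (∀ A → A ≐ S → size A ≃[1+O C ∙ Δ p ⁻¹⟨ Δ>0 ⟩ ] p)
corollary7 Δ Δ→∞ =
  let P , 4≤Δ = Δ→∞ (fromℕ 4)
  in fromℕ (4 ℕ.* 640) , P ℕ.⊔ 9 , λ p p-prime P≤p →
     RealEstimates.residues-at-prime p p-prime {{prime⇒nonZero p-prime}}
       (ℕ.≤-trans (ℕ.m≤n⊔m P 9) P≤p) (Δ p) (4≤Δ p p-prime (ℕ.≤-trans (ℕ.m≤m⊔n P 9) P≤p))
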